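{- Let $G=(V,E)$ be a graph with $n=|V|$ vertices and $m=|E|$ edges, and let $G'=(V,E')$, $E'\subset E$, be a spectral sparsification of $G$ with $|E'|=O(n\log n)$. The algorithm SSSL-GUMAP, run on $G$ and $G'$ with neighborhood size $k=O(1)$ and sample size exponent $0.9$, runs in $O(n)$ time, where its three components have running times C0: $O(n)$, C1: $O(n)$, C2: $O(n^{0.9})$; and it has space complexity $O(n+m)$.
   Context: The spectral sparsification $G'=(V,E')$ of $G$ is the subgraph computed as a pre-processing step as follows: compute the effective resistance values of all edges of $G$, take a maximum spanning tree with effective resistances as weights, then add further edges of $G$ in decreasing order of effective resistance until $n\log n$ edges are included. So $|E'|=O(n\log n)$. SSSL-GUMAP takes as input $G$, its spectral sparsification $G'$, a neighborhood size $k$, a sample size exponent (here $0.9$), and a number of iterations $t$, and outputs a drawing of $G$, i.e. an assignment $X$ of a point $X_v\in\mathbb{R}^d$ ($d=2$) to each $v\in V$. C0 and C1 (PartialBFS on $G'$): for each vertex $v\in V$, perform a breadth-first search of $G'$ starting from $v$, recording the distance from $v$ to each visited vertex, and stop once $k$ other vertices have been visited (ties between vertices at equal distance from $v$ are broken at random). The recorded distances form a partial distance matrix (entries not recorded are regarded as infinite), and the pairs $(v,u)$ with $u$ visited in the search from $v$ form the edge set $E_k$ of the $k$-nearest-neighbor graph $G_k=(V,E_k)$, so C0 (distance computation) and C1 ($k$-nearest-neighbor graph computation) are done together and $|E_k|=O(kn)$. An edge between $v_i$ and its neighbor $v_j$ is weighted by $h_{ij}=\exp[-(d_{ij}-\rho_i)/\sigma_i]$,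 where $d_{ij}$ is the recorded distance, $\rho_i$ is the distance from $v_i$ to its nearest neighbor and $\sigma_i$ is a bandwidth parameter. C2 (GradSample): initialize $X$ by a spectral layout. Shuffle the array $E_k$, set $s=\lfloor |E_k|^{0.9}\rfloor$ and a starting index $j=0$. In each of $t$ iterations, for the (at most $s+1$) edges $(a,b)$ of $E_k$ at indices $(j+i)\bmod |E_k|$, $0\le i\le s$, compute $w_{ab}=(1+\alpha\|X_a-X_b\|_2^{2\beta})^{ -1}$ (where $\alpha,\beta>0$ are constants), compute the gradient at $a,b$ (based on $w_{ab}$) of the cost $$C=\sum_{i\ne j}h_{ij}\log\frac{h_{ij}}{w_{ij}}+(1-h_{ij})\log\frac{1-h_{ij}}{1-w_{ij}},$$ and move $X_a,X_b$ based on the gradient; then replace $j$ by $(j+s)\bmod|E_k|$. The resulting drawing of $G'$, with all edges of $G$ added in, is returned. Conventions: $k$ and $d$ are constants with respect to $n$. The pre-processing that computes $G'$, and the $O(n+m)$ time for reading the input and rendering the output, are omitted from running times. The running time of C2 refers to one iteration of the gradient descent (the number $t$ of iterations is treated as a constant, and the initialization is not counted). The overall running time is that of C0, C1 and C2 combined. The space complexity includes storage of the input graph. -}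

module Defs where

open import Data.Bool as Bool using (Bool; true; if_then_else_; _∧_)
open import Data.Fin as Fin using (Fin; toℕ; fromℕ<; #_)
open import Data.List using (List; []; _∷_; _++_; _∷ʳ_; length; map; concat; concatMap; take; allFin; upTo; foldr)
open import Data.List.Membership.Propositional using (_∈_; _∉_)
open import Data.List.Relation.Binary.Subset.Propositional using (_⊆_)
open import Data.List.Relation.Unary.All using (All)
open import Data.List.Relation.Unary.Linked using (Linked)
open import Data.List.Relation.Unary.Unique.Propositional using (Unique)
open import Data.Nat using (ℕ; zero; suc; _+_; _∸_; _*_; _^_; _≤_; _⊔_; _⊓_; _<ᵇ_; _≡ᵇ_; _<?_)
open import Data.Nat.DivMod using (_/_; _%_)
open import Data.Nat.ListAction using (sum)
open import Data.Nat.Logarithm using (⌈log₂_⌉)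
open import Data.Product using (_×_; _,_; ∃-syntax; proj₁; proj₂; uncurry)
open import Data.Rational as ℚ using (ℚ; 0ℚ; 1ℚ)
open import Data.Sum using (_⊎_)
open import Data.Vec.Functional as Vector using (Vector)
open import Function using (_∘_; const)
open import Relation.Binary.Construct.Closure.ReflexiveTransitive using (Star)
open import Relation.Binary.PropositionalEquality using (_≡_)
open import Relation.Nullary using (¬_; yes; no; does)

------------------------------------------------------------------------
-- Graphs and spectral sparsification

-- Finite simple undirected graphs: {a , b} is listed once, as (a , b)
-- with a < b.

record Graph (n : ℕ) : Set where
  field
    edges   : List (Fin n × Fin n)
    ordered : All (uncurry Fin._<_) edges
    unique  : Unique edges

open Graph public using (edges)

module _ {n : ℕ} where

  ∣E_∣ : Graph n → ℕ
  ∣E G ∣ = length (edges G)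

  Adjacent : Graph n → Fin n → Fin n → Set
  Adjacent G a b = (a , b) ∈ edges G ⊎ (b , a) ∈ edges G

  neighbours : Graph n → Fin n → List (Fin n)
  neighbours G v = concatMap other (edges G)
    where
    other : Fin n × Fin n → List (Fin n)
    other (a , b) = (if does (a Fin.≟ v) then b ∷ [] else [])
                 ++ (if does (b Fin.≟ v) then a ∷ [] else [])

  sumℚ : List ℚ → ℚ
  sumℚ = foldr ℚ._+_ 0ℚ

  -- (L φ)(x) for the Laplacian L of G
  netCurrent : Graph n → (Fin n → ℚ) → Fin n → ℚ
  netCurrent G φ x = sumℚ (map (λ y → φ x ℚ.- φ y) (neighbours G x))

  δ : Fin n → Fin n → ℚ
  δ a x = if does (a Fin.≟ x) then 1ℚ else 0ℚ

  -- Every edge is a unit resistor; r is the potential difference between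
  -- a and b when a unit current flows from a to b.  Potentials solve a
  -- linear system over ℚ, so effective resistances are rational.
  IsEffectiveResistance : Graph n → Fin n × Fin n → ℚ → Set
  IsEffectiveResistance G (a , b) r =
    ∃[ φ ] (∀ x → netCurrent G φ x ≡ δ a x ℚ.- δ b x) × r ≡ φ a ℚ.- φ b

  record Cycle (G : Graph n) : Set where
    field
      start  : Fin n
      others : List (Fin n)
      long   : 2 ≤ length others
      simple : Unique (start ∷ others)
      closed : Linked (Adjacent G) (start ∷ others ∷ʳ start)

  -- A spanning tree when G is connected, and a spanning forest otherwise.
  record IsSpanningTree (G T : Graph n) : Set where
    field
      subgraph : edges T ⊆ edges G
      acyclic  : ¬ Cycle T
      spanning : ∀ {a b} → Star (Adjacent G) a b → Star (Adjacent T) a b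

  weight : (Fin n × Fin n → ℚ) → Graph n → ℚ
  weight w T = sumℚ (map w (edges T))

  record IsMaximumSpanningTree (G : Graph n) (w : Fin n × Fin n → ℚ) (T : Graph n) : Set where
    field
      isSpanningTree : IsSpanningTree G T
      maximum        : ∀ T′ → IsSpanningTree G T′ → weight w T′ ℚ.≤ weight w T

-- ⌈n log n⌉, as n log₂ n = log₂ (nⁿ)
⌈_log_⌉ : ℕ → ℕ → ℕ
⌈ n log m ⌉ = ⌈log₂ (m ^ n) ⌉

record IsSpectralSparsification {n : ℕ} (G G′ : Graph n) : Set where
  field
    subgraph     : edges G′ ⊆ edges G
    resistance   : Fin n × Fin n → ℚ
    isResistance : ∀ {e} → e ∈ edges G → IsEffectiveResistance G e (resistance e)
    tree         : Graph n
    isMaximum    : IsMaximumSpanningTree G resistance tree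
    tree⊆        : edges tree ⊆ edges G′
    decreasing   : ∀ {e f} → e ∈ edges G′ → e ∉ edges tree →
                   f ∈ edges G → f ∉ edges G′ → resistance f ℚ.≤ resistance e
    -- The tree is kept whole, and there may be fewer than n log n edges.
    size         : ∣E G′ ∣ ≡ ∣E tree ∣ ⊔ (∣E G ∣ ⊓ ⌈ n log n ⌉)

------------------------------------------------------------------------
-- A real RAM

-- The machine treats reals as opaque words with unit-cost operations, so
-- no laws are required; the real numbers are one instance.

record RealArithmetic : Set₁ where
  field
    ℝ                    : Set
    fromℕ                : ℕ → ℝ
    add sub mul div pow  : ℝ → ℝ → ℝ
    neg exp              : ℝ → ℝ
    _less_               : ℝ → ℝ → Set

data Sort : Set where
  int real : Sort

data Reg (s : Sort) : Set where
  reg : Fin 32 → Reg s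

data Arr (s : Sort) : Set where
  arr : Fin 16 → Arr s

infix  9 !_ _[_]
infixl 7 _⊗_ _⊘_ _mod_
infixl 6 _⊕_ _⊖_

data Exp : Sort → Set where
  lit         : ℕ → Exp int
  !_          : ∀ {s} → Reg s → Exp s
  _[_]        : ∀ {s} → Arr s → Exp int → Exp s
  _⊕_ _⊖_ _⊗_ : ∀ {s} → Exp s → Exp s → Exp s
  _mod_       : Exp int → Exp int → Exp int
  toReal      : Exp int → Exp real
  _⊘_ pow     : Exp real → Exp real → Exp real
  neg exp     : Exp real → Exp real

infix  5 _≺_ _≐_
infixr 4 _and_

data Test : Set where
  always  : Test
  _≺_ _≐_ : Exp int → Exp int → Test
  not_    : Test → Test
  _and_   : Test → Test → Test

infix  3 _≔_ _[_]≔_ _≔random_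
infixr 2 _⨾_

data Cmd : Set where
  _≔_        : ∀ {s} → Reg s → Exp s → Cmd
  _[_]≔_     : ∀ {s} → Arr s → Exp int → Exp s → Cmd
  -- x ≔random e draws x from {0, …, e − 1}.
  _≔random_  : Reg int → Exp int → Cmd
  -- A fresh array of the given length, filled with zeroes.
  alloc      : ∀ {s} → Arr s → Exp int → Cmd
  _⨾_        : Cmd → Cmd → Cmd
  when       : Test → Cmd → Cmd
  -- repeat e b c is "while b do c", cut off after e rounds (e is evaluated
  -- once, on entry).  Hence every program terminates.
  repeat     : Exp int → Test → Cmd → Cmd

module Semantics (ℛ : RealArithmetic) where

  module R = RealArithmetic ℛ

  Val : Sort → Set
  Val int  = ℕ
  Val real = R.ℝ

  zeroVal : ∀ s → Val s
  zeroVal int  = 0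
  zeroVal real = R.fromℕ 0

  record Array (s : Sort) : Set where
    constructor array
    field
      {size} : ℕ
      cells  : Vector (Val s) size

  -- Out-of-bounds reads yield 0 and out-of-bounds writes have no effect.

  read : ∀ {s} → Array s → ℕ → Val s
  read {s} (array {size} cells) i with i <? size
  ... | yes i<size = cells (fromℕ< i<size)
  ... | no  _      = zeroVal s

  write : ∀ {s} → Array s → ℕ → Val s → Array s
  write (array {size} cells) i x with i <? size
  ... | yes i<size = array (Vector.updateAt cells (fromℕ< i<size) (const x))
  ... | no  _      = array cells

  record State : Set where
    constructor state
    field
      regs  : ∀ s → Vector (Val s) 32
      arrs  : ∀ s → Vector (Array s) 16
      coins : ℕ → ℕ
      -- Memory is never freed, so this is also the peak memory use.
      used  : ℕ

  open State

  update : ∀ {F : Sort → Set} {m} → (∀ s → Vector (F s) m) →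
           ∀ {s} → Fin m → F s → ∀ s → Vector (F s) m
  update f {int}  i x int  = Vector.updateAt (f int) i (const x)
  update f {int}  i x real = f real
  update f {real} i x int  = f int
  update f {real} i x real = Vector.updateAt (f real) i (const x)

  setReg : ∀ {s} → Reg s → Val s → State → State
  setReg {s} (reg x) a σ = record σ { regs = update {Val} (regs σ) {s} x a }

  setArr : ∀ {s} → Arr s → Array s → State → State
  setArr (arr a) xs σ = record σ { arrs = update {Array} (arrs σ) a xs }

  getReg : ∀ {s} → Reg s → State → Val s
  getReg {s} (reg x) σ = regs σ s x

  getArr : ∀ {s} → Arr s → State → Array s
  getArr {s} (arr a) σ = arrs σ s a

  -- An input array also counts towards the space.
  input : ∀ {s} → Arr s → Array s → State → State
  input a xs σ = setArr a xs (record σ { used = used σ + Array.size xs })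

  -- All 64 registers are counted as used.
  blank : (ℕ → ℕ) → State
  blank coins = state (λ s _ → zeroVal s) (λ _ _ → array Vector.[]) coins 64

  plus minus times : ∀ s → Val s → Val s → Val s
  plus  int  = _+_
  plus  real = R.add
  minus int  = _∸_
  minus real = R.sub
  times int  = _*_
  times real = R.mul

  modulo : ℕ → ℕ → ℕ
  modulo m zero    = 0
  modulo m (suc n) = m % suc n

  ⟦_⟧ : ∀ {s} → Exp s → State → Val s
  ⟦ lit m ⟧              σ = m
  ⟦ ! x ⟧                σ = getReg x σ
  ⟦ a [ e ] ⟧            σ = read (getArr a σ) (⟦ e ⟧ σ)
  ⟦ _⊕_ {s} e₁ e₂ ⟧      σ = plus s (⟦ e₁ ⟧ σ) (⟦ e₂ ⟧ σ)
  ⟦ _⊖_ {s} e₁ e₂ ⟧      σ = minus s (⟦ e₁ ⟧ σ) (⟦ e₂ ⟧ σ)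
  ⟦ _⊗_ {s} e₁ e₂ ⟧      σ = times s (⟦ e₁ ⟧ σ) (⟦ e₂ ⟧ σ)
  ⟦ e₁ mod e₂ ⟧          σ = modulo (⟦ e₁ ⟧ σ) (⟦ e₂ ⟧ σ)
  ⟦ toReal e ⟧           σ = R.fromℕ (⟦ e ⟧ σ)
  ⟦ e₁ ⊘ e₂ ⟧            σ = R.div (⟦ e₁ ⟧ σ) (⟦ e₂ ⟧ σ)
  ⟦ pow e₁ e₂ ⟧          σ = R.pow (⟦ e₁ ⟧ σ) (⟦ e₂ ⟧ σ)
  ⟦ neg e ⟧              σ = R.neg (⟦ e ⟧ σ)
  ⟦ exp e ⟧              σ = R.exp (⟦ e ⟧ σ)

  cost : ∀ {s} → Exp s → ℕ
  cost (lit _)      = 1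
  cost (! _)        = 1
  cost (_ [ e ])    = 1 + cost e
  cost (e₁ ⊕ e₂)    = 1 + cost e₁ + cost e₂
  cost (e₁ ⊖ e₂)    = 1 + cost e₁ + cost e₂
  cost (e₁ ⊗ e₂)    = 1 + cost e₁ + cost e₂
  cost (e₁ mod e₂)  = 1 + cost e₁ + cost e₂
  cost (toReal e)   = 1 + cost e
  cost (e₁ ⊘ e₂)    = 1 + cost e₁ + cost e₂
  cost (pow e₁ e₂)  = 1 + cost e₁ + cost e₂
  cost (neg e)      = 1 + cost e
  cost (exp e)      = 1 + cost e

  holds : Test → State → Bool
  holds always      σ = true
  holds (e₁ ≺ e₂)   σ = ⟦ e₁ ⟧ σ <ᵇ ⟦ e₂ ⟧ σ
  holds (e₁ ≐ e₂)   σ = ⟦ e₁ ⟧ σ ≡ᵇ ⟦ e₂ ⟧ σ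
  holds (not b)     σ = Bool.not (holds b σ)
  holds (b₁ and b₂) σ = holds b₁ σ ∧ holds b₂ σ

  testCost : Test → ℕ
  testCost always      = 1
  testCost (e₁ ≺ e₂)   = 1 + cost e₁ + cost e₂
  testCost (e₁ ≐ e₂)   = 1 + cost e₁ + cost e₂
  testCost (not b)     = 1 + testCost b
  testCost (b₁ and b₂) = 1 + testCost b₁ + testCost b₂

  runLoop : ℕ → Test → (State → State) → State → State
  runLoop zero    b f σ = σ
  runLoop (suc m) b f σ = if holds b σ then runLoop m b f (f σ) else σ

  timeLoop : ℕ → Test → (State → State) → (State → ℕ) → State → ℕ
  timeLoop zero    b f τ σ = 1
  timeLoop (suc m) b f τ σ =
    1 + testCost b + (if holds b σ then τ σ + timeLoop m b f τ (f σ) else 0)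

  run : Cmd → State → State
  run (x ≔ e)          σ = setReg x (⟦ e ⟧ σ) σ
  run (a [ e ]≔ e′)    σ = setArr a (write (getArr a σ) (⟦ e ⟧ σ) (⟦ e′ ⟧ σ)) σ
  run (x ≔random e)    σ = setReg x (modulo (coins σ 0) (⟦ e ⟧ σ))
                                    (record σ { coins = coins σ ∘ suc })
  run (alloc {s} a e)  σ = input a (array (Vector.replicate (⟦ e ⟧ σ) (zeroVal s))) σ
  run (c₁ ⨾ c₂)        σ = run c₂ (run c₁ σ)
  run (when b c)       σ = if holds b σ then run c σ else σ
  run (repeat e b c)   σ = runLoop (⟦ e ⟧ σ) b (run c) σ

  time : Cmd → State → ℕ
  time (x ≔ e)         σ = 1 + cost e
  time (a [ e ]≔ e′)   σ = 1 + cost e + cost e′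
  time (x ≔random e)   σ = 1 + cost e
  time (alloc a e)     σ = 1 + cost e + ⟦ e ⟧ σ
  time (c₁ ⨾ c₂)       σ = time c₁ σ + time c₂ (run c₁ σ)
  time (when b c)      σ = 1 + testCost b + (if holds b σ then time c σ else 0)
  time (repeat e b c)  σ = 1 + cost e + timeLoop (⟦ e ⟧ σ) b (run c) (time c) σ

------------------------------------------------------------------------
-- SSSL-GUMAP

module Program where

  -- Input.  The edges of G are stored in graph.  The adjacency lists of G′
  -- are stored consecutively in adjacent, the list of vertex u occupying the
  -- positions from offset[u] up to but excluding offset[u + 1].  Coordinate
  -- c of X_u is stored at position u·d + c.

  n k d t : Reg int
  n = reg (# 0)
  k = reg (# 1)
  d = reg (# 2)
  t = reg (# 3)

  -- η is the step length of the gradient descent.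
  α β η : Reg real
  α = reg (# 0)
  β = reg (# 1)
  η = reg (# 2)

  graph offset adjacent : Arr int
  graph    = arr (# 0)
  offset   = arr (# 1)
  adjacent = arr (# 2)

  σ X : Arr real
  σ = arr (# 0)
  X = arr (# 1)

  -- Work space.  M = |E_k|, and the e-th entry of E_k is the edge from
  -- source[e] to target[e] with its recorded distance[e] and weight h[e].
  -- The remaining entries of the distance matrix are infinite.

  M : Reg int
  M = reg (# 4)

  source target distance : Arr int
  source   = arr (# 3)
  target   = arr (# 4)
  distance = arr (# 5)

  ρ h : Arr real
  ρ = arr (# 2)
  h = arr (# 3)

  -- mark[w] = v + 1 if the search from v has visited w.
  mark queue level : Arr int
  mark  = arr (# 6)
  queue = arr (# 7)
  level = arr (# 8)

  v u w l lo p head tail e a b c i j s round tmp : Reg int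
  v     = reg (# 5)
  u     = reg (# 6)
  w     = reg (# 7)
  l     = reg (# 8)
  lo    = reg (# 9)
  p     = reg (# 10)
  head  = reg (# 11)
  tail  = reg (# 12)
  e     = reg (# 13)
  a     = reg (# 14)
  b     = reg (# 15)
  c     = reg (# 16)
  i     = reg (# 17)
  j     = reg (# 18)
  s     = reg (# 19)
  round = reg (# 20)
  tmp   = reg (# 21)

  tmpʳ z ω γ Δ : Reg real
  tmpʳ = reg (# 3)
  z    = reg (# 4)
  ω    = reg (# 5)
  γ    = reg (# 6)
  Δ    = reg (# 7)

  swap : Arr int → Reg int → Reg int → Cmd
  swap A x y = tmp ≔ A [ ! x ] ⨾ A [ ! x ]≔ A [ ! y ] ⨾ A [ ! y ]≔ ! tmp

  swapʳ : Arr real → Reg int → Reg int → Cmd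
  swapʳ A x y = tmpʳ ≔ A [ ! x ] ⨾ A [ ! x ]≔ A [ ! y ] ⨾ A [ ! y ]≔ ! tmpʳ

  visit : Cmd
  visit =
    mark [ ! w ]≔ ! v ⊕ lit 1 ⨾
    queue [ ! tail ]≔ ! w ⨾
    level [ ! tail ]≔ ! l ⊕ lit 1 ⨾
    source [ ! M ]≔ ! v ⨾
    target [ ! M ]≔ ! w ⨾
    distance [ ! M ]≔ ! l ⊕ lit 1 ⨾
    M ≔ ! M ⊕ lit 1 ⨾
    -- The first visited vertex is a nearest neighbour of v.
    when (! tail ≐ lit 1) (ρ [ ! v ]≔ toReal (! l ⊕ lit 1)) ⨾
    tail ≔ ! tail ⊕ lit 1

  -- The neighbours of u are taken in random order, the list being shuffled
  -- in place as far as it is read.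
  scan : Cmd
  scan =
    u ≔ queue [ ! head ] ⨾
    l ≔ level [ ! head ] ⨾
    lo ≔ offset [ ! u ] ⨾
    repeat (offset [ ! u ⊕ lit 1 ] ⊖ ! lo) (! tail ≺ ! k ⊕ lit 1)
      ( p ≔random offset [ ! u ⊕ lit 1 ] ⊖ ! lo ⨾
        p ≔ ! lo ⊕ ! p ⨾
        swap adjacent lo p ⨾
        w ≔ adjacent [ ! lo ] ⨾
        lo ≔ ! lo ⊕ lit 1 ⨾
        when (not (mark [ ! w ] ≐ ! v ⊕ lit 1)) visit ) ⨾
    head ≔ ! head ⊕ lit 1

  -- The queue holds v and the tail − 1 other vertices visited so far.  As
  -- head < tail ≤ k holds in each round, the cut-off at k is never binding.
  search : Cmd
  search =
    mark [ ! v ]≔ ! v ⊕ lit 1 ⨾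
    queue [ lit 0 ]≔ ! v ⨾
    level [ lit 0 ]≔ lit 0 ⨾
    head ≔ lit 0 ⨾
    tail ≔ lit 1 ⨾
    repeat (! k) (! head ≺ ! tail and ! tail ≺ ! k ⊕ lit 1) scan

  partialBFS : Cmd
  partialBFS =
    alloc mark (! n) ⨾
    alloc queue (! k ⊕ lit 1) ⨾
    alloc level (! k ⊕ lit 1) ⨾
    alloc source (! n ⊗ ! k) ⨾
    alloc target (! n ⊗ ! k) ⨾
    alloc distance (! n ⊗ ! k) ⨾
    alloc ρ (! n) ⨾
    M ≔ lit 0 ⨾
    v ≔ lit 0 ⨾
    repeat (! n) always (search ⨾ v ≔ ! v ⊕ lit 1)

  weigh : Cmd
  weigh =
    alloc h (! n ⊗ ! k) ⨾
    e ≔ lit 0 ⨾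
    repeat (! M) always
      ( a ≔ source [ ! e ] ⨾
        h [ ! e ]≔ exp (neg ((toReal (distance [ ! e ]) ⊖ ρ [ ! a ]) ⊘ σ [ ! a ])) ⨾
        e ≔ ! e ⊕ lit 1 )

  knnGraph : Cmd
  knnGraph = partialBFS ⨾ weigh

  shuffle : Cmd
  shuffle =
    e ≔ lit 0 ⨾
    repeat (! M) always
      ( p ≔random ! M ⊖ ! e ⨾
        p ≔ ! e ⊕ ! p ⨾
        swap source e p ⨾
        swap target e p ⨾
        swap distance e p ⨾
        swapʳ h e p ⨾
        e ≔ ! e ⊕ lit 1 )

  power : Exp int → ℕ → Exp int
  power x zero          = lit 1
  power x (suc zero)    = x
  power x (suc (suc m)) = x ⊗ power x (suc m)

  -- s = ⌊M^0.9⌋ is the largest s with s¹⁰ ≤ M⁹; it is at most M.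
  sampleSize : Cmd
  sampleSize =
    s ≔ lit 0 ⨾
    repeat (! M) (power (! s ⊕ lit 1) 10 ≺ power (! M) 9 ⊕ lit 1)
      (s ≔ ! s ⊕ lit 1)

  initialise : Cmd
  initialise = shuffle ⨾ sampleSize ⨾ j ≔ lit 0

  -- The summand of C for (a , b), with z = ‖X_a − X_b‖² and
  -- ω = w_ab = 1 / (1 + α z^β), has gradient
  --   2 (h αβ z^(β−1) ω − (1 − h) (β / z) ω) (X_a − X_b)
  --     = 2 β (h − ω) / z (X_a − X_b)
  -- with respect to X_a, because α z^β ω = 1 − ω, and the opposite one with
  -- respect to X_b.
  descend : Cmd
  descend =
    a ≔ source [ ! e ] ⨾
    b ≔ target [ ! e ] ⨾
    z ≔ toReal (lit 0) ⨾
    c ≔ lit 0 ⨾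
    repeat (! d) always
      ( Δ ≔ X [ ! a ⊗ ! d ⊕ ! c ] ⊖ X [ ! b ⊗ ! d ⊕ ! c ] ⨾
        z ≔ ! z ⊕ ! Δ ⊗ ! Δ ⨾
        c ≔ ! c ⊕ lit 1 ) ⨾
    ω ≔ toReal (lit 1) ⊘ (toReal (lit 1) ⊕ ! α ⊗ pow (! z) (! β)) ⨾
    γ ≔ toReal (lit 2) ⊗ ! β ⊗ (h [ ! e ] ⊖ ! ω) ⊘ ! z ⨾
    c ≔ lit 0 ⨾
    repeat (! d) always
      ( Δ ≔ ! η ⊗ ! γ ⊗ (X [ ! a ⊗ ! d ⊕ ! c ] ⊖ X [ ! b ⊗ ! d ⊕ ! c ]) ⨾
        X [ ! a ⊗ ! d ⊕ ! c ]≔ X [ ! a ⊗ ! d ⊕ ! c ] ⊖ ! Δ ⨾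
        X [ ! b ⊗ ! d ⊕ ! c ]≔ X [ ! b ⊗ ! d ⊕ ! c ] ⊕ ! Δ ⨾
        c ≔ ! c ⊕ lit 1 )

  -- The test only matters for M ≤ 1, where the indices would repeat (or not
  -- exist).
  iteration : Cmd
  iteration =
    i ≔ lit 0 ⨾
    repeat (! s ⊕ lit 1) (! i ≺ ! M)
      ( e ≔ (! j ⊕ ! i) mod ! M ⨾
        descend ⨾
        i ≔ ! i ⊕ lit 1 ) ⨾
    j ≔ (! j ⊕ ! s) mod ! M

  -- The result is X, drawn with the edges stored in graph.
  SSSL-GUMAP : Cmd
  SSSL-GUMAP = knnGraph ⨾ initialise ⨾ repeat (! t) always iteration

------------------------------------------------------------------------
-- Running time and space

module Complexity (ℛ : RealArithmetic) where

  open Semantics ℛ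
  open RealArithmetic ℛ using (ℝ; fromℕ; _less_)

  intArray : List ℕ → Array int
  intArray xs = array (Vector.fromList xs)

  endpoints : ∀ {n} → Graph n → List ℕ
  endpoints G = concatMap (λ (a , b) → toℕ a ∷ toℕ b ∷ []) (edges G)

  adjacencyLists : ∀ {n} → Graph n → List (List ℕ)
  adjacencyLists {n} G = map (map toℕ ∘ neighbours G) (allFin n)

  offsets : ∀ {n} → Graph n → List ℕ
  offsets {n} G = map (λ i → sum (take i (map length (adjacencyLists G)))) (upTo (suc n))

  -- K bounds the neighbourhood size, d is the dimension of the drawing, t the
  -- number of iterations, and A the constant in |E′| = O(n log n).
  record Instance (K d t A : ℕ) : Set where
    field
      {n}       : ℕ
      G G′      : Graph n
      sparse    : IsSpectralSparsification G G′
      ∣E′∣-bound : ∣E G′ ∣ ≤ A * ⌈ n log n ⌉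
      k         : ℕ
      k≤K       : k ≤ K
      α β η     : ℝ
      α>0       : fromℕ 0 less α
      β>0       : fromℕ 0 less β
      bandwidth : Vector ℝ n
      layout    : Vector (Vector ℝ d) n
      coins     : ℕ → ℕ

    m : ℕ
    m = ∣E G ∣

    start : State
    start =
      setReg Program.n n (setReg Program.k k (setReg Program.d d (setReg Program.t t
      (setReg Program.α α (setReg Program.β β (setReg Program.η η
      (input Program.graph (intArray (endpoints G))
      (input Program.offset (intArray (offsets G′))
      (input Program.adjacent (intArray (concat (adjacencyLists G′)))
      (input Program.σ (array bandwidth)
      (input Program.X (array (Vector.concat layout))
      (blank coins))))))))))))

  open Instance public using (n; m; start)

  module _ {K d t A : ℕ} where

    -- C0 and C1 are done together by partialBFS, which is therefore charged
    -- to both of them; C1 is also charged with the weights.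

    timeC0 : Instance K d t A → ℕ
    timeC0 x = time Program.partialBFS (start x)

    timeC1 : Instance K d t A → ℕ
    timeC1 x = time Program.knnGraph (start x)

    beforeIteration : Instance K d t A → ℕ → State
    beforeIteration x zero    = run Program.initialise (run Program.knnGraph (start x))
    beforeIteration x (suc i) = run Program.iteration (beforeIteration x i)

    timeC2 : Instance K d t A × Fin t → ℕ
    timeC2 (x , i) = time Program.iteration (beforeIteration x (toℕ i))

    timeTotal : Instance K d t A → ℕ
    timeTotal x = time Program.SSSL-GUMAP (start x)

    space : Instance K d t A → ℕ
    space x = State.used (run Program.SSSL-GUMAP (start x))

-- f = O(g), as the size of the instances tends to infinity.
_=O[_]_ : {I : Set} → (I → ℕ) → (I → ℕ) → (I → ℕ) → Set
f =O[ size ] g = ∃[ c ] ∃[ N ] ∀ x → N ≤ size x → f x ≤ c * g x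

-- f = O(g^0.9): the tenth power of f ≤ c · g^0.9.
_=O[_]_^0·9 : {I : Set} → (I → ℕ) → (I → ℕ) → (I → ℕ) → Set
f =O[ size ] g ^0·9 = ∃[ c ] ∃[ N ] ∀ x → N ≤ size x → f x ^ 10 ≤ c ^ 10 * g x ^ 9

{-# OPTIONS --safe #-}

-- Every neighbour read so far while u is scanned is marked, so it is in the
-- queue, and it is read only once because G′ is simple and the shuffling
-- permutes the list of u within its own block.  By the pigeonhole principle a
-- scan therefore takes at most k + 1 rounds, however large the degree of u is,
-- and the whole search from a vertex takes constant time.  It adds at most k
-- entries to E_k, hence M ≤ k n, which bounds the remaining loops; one
-- iteration of the descent has s + 1 rounds with s¹⁰ ≤ M⁹.  Allocating an array
-- costs its length, so the space used beyond the input is at most the time.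
module Submission where

open import Defs
open import Algebra.Properties.CommutativeSemigroup using (interchange)
open import Data.Bool using (true; false; T; if_then_else_)
open import Data.Empty using (⊥)
open import Data.Fin as Fin using (Fin; toℕ; fromℕ<)
open import Data.Fin.Properties using (injective⇒≤; toℕ-injective; fromℕ<-injective; toℕ<n)
open import Data.List using (List; []; _∷_; _++_; length; lookup; map; concat; concatMap; take; allFin; upTo; applyUpTo)
open import Data.List.Membership.Propositional using (_∈_)
open import Data.List.Membership.Propositional.Properties using (∈-lookup)
import Data.List.Membership.Setoid.Properties as Membership
open import Data.List.Properties using (length-++; length-map; length-upTo; map-cong; map-∘)
open import Data.List.Relation.Binary.Disjoint.Propositional using (Disjoint)
open import Data.List.Relation.Binary.Subset.Propositional using (_⊆_)
open import Data.List.Relation.Unary.All as All using (All; []; _∷_)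
import Data.List.Relation.Unary.All.Properties as All
open import Data.List.Relation.Unary.AllPairs using (AllPairs; []; _∷_)
import Data.List.Relation.Unary.AllPairs.Properties as AllPairs
open import Data.List.Relation.Unary.Any using (index; here; there)
open import Data.List.Relation.Unary.Unique.Propositional using (Unique)
import Data.List.Relation.Unary.Unique.Propositional.Properties as Unique
open import Data.Nat using (ℕ; zero; suc; _+_; _∸_; _*_; _^_; _⊔_; _≤_; _<_; _<?_; _≟_; z≤n; s≤s; NonZero; >-nonZero)
open import Data.Nat.DivMod using (m%n<n)
open import Data.Nat.ListAction using (sum)
open import Data.Nat.Properties hiding (_≟_; _<?_)
open import Data.Product using (_×_; _,_; proj₁; proj₂; uncurry; ∃-syntax)
open import Data.Sum using (_⊎_; inj₁; inj₂)
open import Data.Unit using (⊤; tt)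
open import Data.Vec.Functional as Vector using ()
open import Data.Vec.Functional.Properties using (updateAt-updates; updateAt-minimal)
open import Function using (_∘_; id; const)
open import Relation.Binary.PropositionalEquality using (_≡_; _≢_; refl; sym; trans; cong; subst; subst₂; setoid)
open import Relation.Nullary using (yes; no; does; contradiction; ¬_; Dec)
open import Relation.Nullary.Decidable using (False; toWitnessFalse)

-- Lists, blocks and graphs

-- A constant may depend on K, d, t and A only, not on the graph, the coins or the actual k. Every
-- time bound is therefore of the form `∃[ C ] ∀ …` with `_` as its witness: unification assembles C
-- from the program text, outside the scope of the states.
--
-- Time cannot be bounded without some correctness. The fuel of a scan is the degree of u, so a scan
-- is short only by virtue of its loop test, and to exploit that test one needs an invariant about
-- the contents of the marks, the queue and the adjacency array. This array is shared by all n
-- searches and reordered by each, so the distinctness of its entries within a block is carried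
-- through the whole run. The marks are never cleared, as that would cost n per search; the search
-- from v uses v + 1, which exceeds all earlier marks.
--
-- The coins are arbitrary: a draw only has to fall into the unread part of a block, so all bounds
-- are worst-case bounds.

lookup-injective : ∀ {A : Set} {xs : List A} → Unique xs → ∀ {i j} → lookup xs i ≡ lookup xs j → i ≡ j
lookup-injective (x∉ ∷ _) {Fin.zero}  {Fin.zero}  _  = refl
lookup-injective (x∉ ∷ _) {Fin.zero}  {Fin.suc j} eq = contradiction eq (All.lookup x∉ (∈-lookup j))
lookup-injective (x∉ ∷ _) {Fin.suc i} {Fin.zero}  eq = contradiction (sym eq) (All.lookup x∉ (∈-lookup i))
lookup-injective (_ ∷ u)  {Fin.suc i} {Fin.suc j} eq = cong Fin.suc (lookup-injective u eq)

-- Sending each position of `xs` to a position of the same entry in `ys` is injective. This turns E′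
-- ⊆ E into |E′| ≤ m.
Unique-⊆⇒length≤ : ∀ {A : Set} {xs ys : List A} → Unique xs → xs ⊆ ys → length xs ≤ length ys
Unique-⊆⇒length≤ u xs⊆ys = injective⇒≤ {f = λ i → index (xs⊆ys (∈-lookup i))}
  λ eq → lookup-injective u (Membership.index-injective (setoid _) (xs⊆ys (∈-lookup _)) (xs⊆ys (∈-lookup _)) eq)

-- The default 0 agrees with an out-of-bounds `read`, so `read-intArray` needs no bound on the
-- index.
nth : List ℕ → ℕ → ℕ
nth []       _       = 0
nth (x ∷ _)  zero    = x
nth (_ ∷ xs) (suc i) = nth xs i

nth-beyond : ∀ xs {i} → length xs ≤ i → nth xs i ≡ 0
nth-beyond []       _         = refl
nth-beyond (_ ∷ xs) (s≤s ≤i) = nth-beyond xs ≤i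

nth-lookup : ∀ xs {i} (i< : i < length xs) → nth xs i ≡ lookup xs (fromℕ< i<)
nth-lookup (_ ∷ _)  {zero}  _         = refl
nth-lookup (_ ∷ xs) {suc i} (s≤s i<) = nth-lookup xs i<

nth-++ˡ : ∀ xs {ys i} → i < length xs → nth (xs ++ ys) i ≡ nth xs i
nth-++ˡ (_ ∷ _)  {i = zero}  _         = refl
nth-++ˡ (_ ∷ xs) {i = suc i} (s≤s i<) = nth-++ˡ xs i<

nth-++ʳ : ∀ xs {ys i} → length xs ≤ i → nth (xs ++ ys) i ≡ nth ys (i ∸ length xs)
nth-++ʳ []       _         = refl
nth-++ʳ (_ ∷ xs) (s≤s ≤i) = nth-++ʳ xs ≤i

nth-map-applyUpTo : ∀ (f g : ℕ → ℕ) {m i} → i < m → nth (map f (applyUpTo g m)) i ≡ f (g i)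
nth-map-applyUpTo f g {suc m} {zero}  _         = refl
nth-map-applyUpTo f g {suc m} {suc i} (s≤s i<) = nth-map-applyUpTo f (g ∘ suc) i<

-- `off` is kept abstract because it is instantiated both with prefix sums and with the contents of
-- the offset array. The form `i + 1` is what `! u ⊕ lit 1` evaluates to.
record InBlock (off : ℕ → ℕ) (i p : ℕ) : Set where
  constructor inBlock
  field
    first≤ : off i ≤ p
    <next  : p < off (i + 1)

blockStart : List (List ℕ) → ℕ → ℕ
blockStart xss i = sum (take i (map length xss))

blockStart-[] : ∀ i → blockStart [] i ≡ 0
blockStart-[] zero    = refl
blockStart-[] (suc _) = refl

∉-block-[] : ∀ {A : Set} i {p} → InBlock (blockStart []) i p → A
∉-block-[] i (inBlock _ p<) = contradiction (subst (_ <_) (blockStart-[] (i + 1)) p<) λ ()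

inBlock-pred : ∀ xs xss {i p} → InBlock (blockStart (xs ∷ xss)) (suc i) p →
               InBlock (blockStart xss) i (p ∸ length xs)
inBlock-pred xs xss {i} {p} (inBlock ≤p p<) = inBlock
  start≤
  (+-cancelˡ-< (length xs) _ _ (subst (_< _) (sym (m+[n∸m]≡n (m+n≤o⇒m≤o (length xs) ≤p))) p<))
  where
  start≤ : blockStart xss i ≤ p ∸ length xs
  start≤ = subst (_≤ p ∸ length xs) (m+n∸m≡n (length xs) _) (∸-monoˡ-≤ (length xs) ≤p)

block₀< : ∀ xs xss {p} → InBlock (blockStart (xs ∷ xss)) 0 p → p < length xs
block₀< xs xss (inBlock _ p<) = subst (_ <_) (+-identityʳ _) p<

blockₛ≥ : ∀ xs xss i {p} → InBlock (blockStart (xs ∷ xss)) (suc i) p → length xs ≤ p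
blockₛ≥ xs xss i (inBlock ≤p _) = m+n≤o⇒m≤o (length xs) ≤p

-- The length of the first list separates block 0 from the later ones, and dropping that list shifts
-- the later ones. An index past the last list has an empty block, the prefix sums being constant
-- there.
block-unique : ∀ xss i j {p} → InBlock (blockStart xss) i p → InBlock (blockStart xss) j p → i ≡ j
block-unique []         i       _       p∈i _   = ∉-block-[] i p∈i
block-unique (xs ∷ xss) zero    zero    _   _   = refl
block-unique (xs ∷ xss) zero    (suc j) p∈i p∈j = contradiction (blockₛ≥ xs xss j p∈j) (<⇒≱ (block₀< xs xss p∈i))
block-unique (xs ∷ xss) (suc i) zero    p∈i p∈j = contradiction (blockₛ≥ xs xss i p∈i) (<⇒≱ (block₀< xs xss p∈j))
block-unique (xs ∷ xss) (suc i) (suc j) p∈i p∈j =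
  cong suc (block-unique xss i j (inBlock-pred xs xss p∈i) (inBlock-pred xs xss p∈j))

block-inside : ∀ xss i {p} → InBlock (blockStart xss) i p → p < length (concat xss)
block-inside []         i       p∈i = ∉-block-[] i p∈i
block-inside (xs ∷ xss) zero    p∈i =
  <-≤-trans (block₀< xs xss p∈i) (≤-trans (m≤m+n _ _) (≤-reflexive (sym (length-++ xs))))
block-inside (xs ∷ xss) (suc i) {p} p∈i = begin-strict
  p                                  ≡⟨ m+[n∸m]≡n (blockₛ≥ xs xss i p∈i) ⟨
  length xs + (p ∸ length xs)        <⟨ +-monoʳ-< (length xs) (block-inside xss i (inBlock-pred xs xss p∈i)) ⟩
  length xs + length (concat xss)    ≡⟨ length-++ xs ⟨
  length (xs ++ concat xss)          ∎
  where open ≤-Reasoning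

block-injective : ∀ {xss} → All Unique xss → ∀ i {p q} →
                  InBlock (blockStart xss) i p → InBlock (blockStart xss) i q →
                  nth (concat xss) p ≡ nth (concat xss) q → p ≡ q
block-injective {[]} [] i p∈i _ _ = ∉-block-[] i p∈i
block-injective {xs ∷ xss} (u ∷ _) zero {p} {q} p∈i q∈i eq =
  fromℕ<-injective p q p< q< (lookup-injective u
    (trans (sym (nth-lookup xs p<)) (trans (trans (sym (nth-++ˡ xs p<)) (trans eq (nth-++ˡ xs q<))) (nth-lookup xs q<))))
  where
  p< = block₀< xs xss p∈i
  q< = block₀< xs xss q∈i
block-injective {xs ∷ xss} (_ ∷ us) (suc i) {p} {q} p∈i q∈i eq =
  ∸-cancelʳ-≡ p≥ q≥ (block-injective us i (inBlock-pred xs xss p∈i) (inBlock-pred xs xss q∈i)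
    (trans (sym (nth-++ʳ xs p≥)) (trans eq (nth-++ʳ xs q≥))))
  where
  p≥ = blockₛ≥ xs xss i p∈i
  q≥ = blockₛ≥ xs xss i q∈i

sum-map-+ : ∀ {A : Set} (f g : A → ℕ) xs → sum (map (λ x → f x + g x) xs) ≡ sum (map f xs) + sum (map g xs)
sum-map-+ f g []       = refl
sum-map-+ f g (x ∷ xs) = trans (cong (f x + g x +_) (sum-map-+ f g xs)) (interchange +-commutativeSemigroup (f x) (g x) _ _)

length-concat : ∀ {A : Set} (xss : List (List A)) → length (concat xss) ≡ sum (map length xss)
length-concat []         = refl
length-concat (xs ∷ xss) = trans (length-++ xs) (cong (length xs +_) (length-concat xss))

-- Neighbour lists and degrees

module _ {n : ℕ} where

  indicator : Fin n → Fin n → ℕ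
  indicator a v = if does (a Fin.≟ v) then 1 else 0

  sum-indicator-≡0 : ∀ {a vs} → All (a ≢_) vs → sum (map (indicator a) vs) ≡ 0
  sum-indicator-≡0 []                      = refl
  sum-indicator-≡0 {a} {v ∷ _} (a≢v ∷ a∉) with a Fin.≟ v
  ... | yes a≡v = contradiction a≡v a≢v
  ... | no  _   = sum-indicator-≡0 a∉

  sum-indicator-≤1 : ∀ a {vs} → Unique vs → sum (map (indicator a) vs) ≤ 1
  sum-indicator-≤1 a []                    = z≤n
  sum-indicator-≤1 a {v ∷ _} (v∉ ∷ unique) with a Fin.≟ v
  ... | yes refl = ≤-reflexive (cong suc (sum-indicator-≡0 v∉))
  ... | no  _    = sum-indicator-≤1 a unique

  -- Repeats the function local to `neighbours`, so that lemmas can name it; `neighbours G v` is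
  -- definitionally `concatMap (otherEnds v) (edges G)`.
  otherEnds : Fin n → Fin n × Fin n → List (Fin n)
  otherEnds v (a , b) = (if does (a Fin.≟ v) then b ∷ [] else [])
                     ++ (if does (b Fin.≟ v) then a ∷ [] else [])

  ∈-otherEnds : ∀ v a b {w} → w ∈ otherEnds v (a , b) → (a ≡ v × w ≡ b) ⊎ (b ≡ v × w ≡ a)
  ∈-otherEnds v a b w∈ with a Fin.≟ v | b Fin.≟ v | w∈
  ... | yes a≡v | _       | here w≡b         = inj₁ (a≡v , w≡b)
  ... | yes _   | yes b≡v | there (here w≡a) = inj₂ (b≡v , w≡a)
  ... | no _    | yes b≡v | here w≡a         = inj₂ (b≡v , w≡a)

  otherEnds-unique : ∀ v {(a , b) : Fin n × Fin n} → a Fin.< b → Unique (otherEnds v (a , b))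
  otherEnds-unique v {a , b} a<b with a Fin.≟ v | b Fin.≟ v
  ... | yes _    | no _     = [] ∷ []
  ... | no _     | yes _    = [] ∷ []
  ... | no _     | no _     = []
  ... | yes refl | yes refl = contradiction a<b (<-irrefl refl)

  -- A common entry w makes both edges join v and w. Listed in the same order they coincide; listed
  -- in opposite orders they give both v < w and w < v.
  otherEnds-disjoint : ∀ v {e f} → uncurry Fin._<_ e → uncurry Fin._<_ f → e ≢ f →
                       Disjoint (otherEnds v e) (otherEnds v f)
  otherEnds-disjoint v {a , b} {c , d} e< f< e≢f (w∈e , w∈f) with ∈-otherEnds v a b w∈e | ∈-otherEnds v c d w∈f
  ... | inj₁ (refl , refl) | inj₁ (refl , refl) = e≢f refl
  ... | inj₁ (refl , refl) | inj₂ (refl , refl) = <-asym e< f<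
  ... | inj₂ (refl , refl) | inj₁ (refl , refl) = <-asym e< f<
  ... | inj₂ (refl , refl) | inj₂ (refl , refl) = e≢f refl

  concatMap-otherEnds-unique : ∀ v {es} → All (uncurry Fin._<_) es → Unique es → Unique (concatMap (otherEnds v) es)
  concatMap-otherEnds-unique v {es} ordered unique = Unique.concat⁺
    (All.map⁺ (All.map (otherEnds-unique v) ordered))
    (AllPairs.map⁺ (disjoint ordered unique))
    where
    disjoint : ∀ {es} → All (uncurry Fin._<_) es → Unique es →
               AllPairs (λ e f → Disjoint (otherEnds v e) (otherEnds v f)) es
    disjoint []        []       = []
    disjoint {e ∷ _} (o ∷ os) (u ∷ us) =
      All.map {Q = Disjoint (otherEnds v e) ∘ otherEnds v} (λ (o′ , e≢f) → otherEnds-disjoint v o o′ e≢f)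
        (All.zip (os , u)) ∷ disjoint os us

  neighbours-unique : ∀ (G : Graph n) v → Unique (neighbours G v)
  neighbours-unique G v = concatMap-otherEnds-unique v (Graph.ordered G) (Graph.unique G)

  length-otherEnds : ∀ v a b → length (otherEnds v (a , b)) ≡ indicator a v + indicator b v
  length-otherEnds v a b with a Fin.≟ v | b Fin.≟ v
  ... | yes _ | yes _ = refl
  ... | yes _ | no _  = refl
  ... | no _  | yes _ = refl
  ... | no _  | no _  = refl

  sum-length-otherEnds : ∀ {vs} → Unique vs → ∀ e → sum (map (λ v → length (otherEnds v e)) vs) ≤ 2
  sum-length-otherEnds {vs} unique (a , b) = begin
    sum (map (λ v → length (otherEnds v (a , b))) vs)         ≡⟨ cong sum (map-cong (λ v → length-otherEnds v a b) vs) ⟩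
    sum (map (λ v → indicator a v + indicator b v) vs)        ≡⟨ sum-map-+ (indicator a) (indicator b) vs ⟩
    sum (map (indicator a) vs) + sum (map (indicator b) vs)   ≤⟨ +-mono-≤ (sum-indicator-≤1 a unique) (sum-indicator-≤1 b unique) ⟩
    2                                                         ∎
    where open ≤-Reasoning

  -- The handshake bound, by induction on the edges: as `vs` has no repetitions, each end of an edge
  -- is counted for at most one vertex.
  sum-degrees : ∀ {vs} → Unique vs → ∀ es →
                sum (map (λ v → length (concatMap (otherEnds v) es)) vs) ≤ 2 * length es
  sum-degrees {vs} unique []       = ≤-reflexive (sum-zeros vs)
    where
    sum-zeros : ∀ (vs : List (Fin n)) → sum (map (λ _ → 0) vs) ≡ 0
    sum-zeros []       = refl
    sum-zeros (_ ∷ vs) = sum-zeros vs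
  sum-degrees {vs} unique (e ∷ es) = begin
    sum (map (λ v → length (otherEnds v e ++ concatMap (otherEnds v) es)) vs)
      ≡⟨ cong sum (map-cong (λ v → length-++ (otherEnds v e)) vs) ⟩
    sum (map (λ v → length (otherEnds v e) + length (concatMap (otherEnds v) es)) vs)
      ≡⟨ sum-map-+ (λ v → length (otherEnds v e)) _ vs ⟩
    sum (map (λ v → length (otherEnds v e)) vs) + sum (map (λ v → length (concatMap (otherEnds v) es)) vs)
      ≤⟨ +-mono-≤ (sum-length-otherEnds unique e) (sum-degrees unique es) ⟩
    2 + 2 * length es
      ≡⟨ *-suc 2 (length es) ⟨
    2 * suc (length es) ∎
    where open ≤-Reasoning

i<n∸m⇒m+i<n : ∀ {i} n m → i < n ∸ m → m + i < n
i<n∸m⇒m+i<n n m i< = ≰⇒> λ n≤m+i → <⇒≱ i< (m≤n+o⇒m∸n≤o n m n≤m+i)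

-- Transpositions of array positions

module Transposition (a b : ℕ) where

  -- `b` is tested first because the swap writes position `b` last. The two positions coincide
  -- whenever the random draw is 0.
  transpose : ℕ → ℕ
  transpose j with j ≟ b | j ≟ a
  ... | yes _ | _     = a
  ... | no  _ | yes _ = b
  ... | no  _ | no  _ = j

  transpose-b : transpose b ≡ a
  transpose-b with b ≟ b
  ... | yes _   = refl
  ... | no  b≢b = contradiction refl b≢b

  transpose-a : transpose a ≡ b
  transpose-a with a ≟ b | a ≟ a
  ... | yes a≡b | _       = a≡b
  ... | no  _   | yes _   = refl
  ... | no  _   | no  a≢a = contradiction refl a≢a

  transpose-other : ∀ {j} → j ≢ b → j ≢ a → transpose j ≡ j
  transpose-other {j} j≢b j≢a with j ≟ b | j ≟ a
  ... | yes j≡b | _       = contradiction j≡b j≢b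
  ... | no  _   | yes j≡a = contradiction j≡a j≢a
  ... | no  _   | no  _   = refl

  transpose-involutive : ∀ j → transpose (transpose j) ≡ j
  transpose-involutive j = by (j ≟ b) (j ≟ a)
    where
    by : Dec (j ≡ b) → Dec (j ≡ a) → transpose (transpose j) ≡ j
    by (yes refl) _          = trans (cong transpose transpose-b) transpose-a
    by (no _)     (yes refl) = trans (cong transpose transpose-a) transpose-b
    by (no j≢b)   (no j≢a)   = trans (cong transpose (transpose-other j≢b j≢a)) (transpose-other j≢b j≢a)

  transpose-injective : ∀ {i j} → transpose i ≡ transpose j → i ≡ j
  transpose-injective {i} {j} eq =
    trans (sym (transpose-involutive i)) (trans (cong transpose eq) (transpose-involutive j))


-- Arithmetic of the exponent 0.9

^-distribʳ-* : ∀ m n p → (m * n) ^ p ≡ m ^ p * n ^ p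
^-distribʳ-* m n zero    = refl
^-distribʳ-* m n (suc p) = trans (cong (m * n *_) (^-distribʳ-* m n p)) ([m*n]*[o*p]≡[m*o]*[n*p] m n (m ^ p) (n ^ p))

-- For s = 0 the hypothesis on `s` says nothing about `s + 1`, so `s + 1` is first replaced by 2 *
-- (s ⊔ 1), the origin of the factor 2. Taking `suc K` in place of `K` keeps (suc K * n) ^ q
-- positive, which settles s = 0, and lets the exponent of `suc K` grow from q to p.
^-scale : ∀ {C S s M K n p q} → q ≤ p → 1 ≤ n → S ≤ C * (s + 1) → s ^ p ≤ M ^ q → M ≤ K * n →
          S ^ p ≤ (C * (2 * suc K)) ^ p * n ^ q
^-scale {C} {S} {s} {M} {K} {n} {p} {q} q≤p 1≤n S≤ sᵖ≤ M≤ = begin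
  S ^ p                                    ≤⟨ ^-monoˡ-≤ p (≤-trans S≤ (*-monoʳ-≤ C (s+1≤ s))) ⟩
  (C * (2 * (s ⊔ 1))) ^ p                  ≡⟨ cong (_^ p) (*-assoc C 2 (s ⊔ 1)) ⟨
  (C * 2 * (s ⊔ 1)) ^ p                    ≡⟨ ^-distribʳ-* (C * 2) (s ⊔ 1) p ⟩
  (C * 2) ^ p * (s ⊔ 1) ^ p                ≤⟨ *-monoʳ-≤ ((C * 2) ^ p) (⊔1-bound s sᵖ≤) ⟩
  (C * 2) ^ p * (suc K * n) ^ q            ≡⟨ cong ((C * 2) ^ p *_) (^-distribʳ-* (suc K) n q) ⟩
  (C * 2) ^ p * (suc K ^ q * n ^ q)        ≤⟨ *-monoʳ-≤ ((C * 2) ^ p) (*-monoˡ-≤ (n ^ q) (^-monoʳ-≤ (suc K) q≤p)) ⟩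
  (C * 2) ^ p * (suc K ^ p * n ^ q)        ≡⟨ *-assoc ((C * 2) ^ p) (suc K ^ p) (n ^ q) ⟨
  (C * 2) ^ p * suc K ^ p * n ^ q          ≡⟨ cong (_* n ^ q) (^-distribʳ-* (C * 2) (suc K) p) ⟨
  (C * 2 * suc K) ^ p * n ^ q              ≡⟨ cong (λ x → x ^ p * n ^ q) (*-assoc C 2 (suc K)) ⟩
  (C * (2 * suc K)) ^ p * n ^ q            ∎
  where
  open ≤-Reasoning
  s+1≤ : ∀ s → s + 1 ≤ 2 * (s ⊔ 1)
  s+1≤ s = ≤-trans (+-mono-≤ (m≤m⊔n s 1) (m≤n⊔m s 1)) (≤-reflexive (cong (s ⊔ 1 +_) (sym (+-identityʳ (s ⊔ 1)))))
  ⊔1-bound : ∀ s → s ^ p ≤ M ^ q → (s ⊔ 1) ^ p ≤ (suc K * n) ^ q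
  ⊔1-bound zero    _   = ≤-trans (≤-reflexive (^-zeroˡ p)) (m^n>0 (suc K * n) {{>-nonZero (*-mono-≤ {1} {suc K} (s≤s z≤n) 1≤n)}} q)
  ⊔1-bound (suc s) sᵖ≤ = ≤-trans (≤-trans (≤-reflexive (cong (λ x → suc x ^ p) (⊔-identityʳ s))) sᵖ≤)
                                 (^-monoˡ-≤ q (≤-trans M≤ (*-monoˡ-≤ n (n≤1+n K))))

-- The first bound gives the exponent 0.9 of an iteration. The second, supplied by the cut-off of
-- the sampling loop, gives the linear bound on an iteration that enters the total time.
record Sampled (M s : ℕ) : Set where
  field
    s¹⁰≤M⁹ : s ^ 10 ≤ M ^ 9
    s≤M    : s ≤ M

sampled⇒sublinear : ∀ S C K n {M s} → 1 ≤ n → S ≤ C * (s + 1) → Sampled M s → M ≤ K * n →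
                    S ^ 10 ≤ (C * (2 * suc K)) ^ 10 * n ^ 9
sampled⇒sublinear S C K n 1≤n S≤ sampled M≤ = ^-scale {C} {K = K} (n≤1+n 9) 1≤n S≤ (Sampled.s¹⁰≤M⁹ sampled) M≤

module Analysis (ℛ : RealArithmetic) where

  open Semantics
  open Complexity

  -- The input arrays of a graph

  module _ {n : ℕ} (G : Graph n) where

    length-adjacencyLists : length (concat (adjacencyLists ℛ G)) ≤ 2 * ∣E G ∣
    length-adjacencyLists = begin
      length (concat (adjacencyLists ℛ G))              ≡⟨ length-concat (adjacencyLists ℛ G) ⟩
      sum (map length (adjacencyLists ℛ G))             ≡⟨ cong sum (map-∘ (allFin n)) ⟨
      sum (map (length ∘ map toℕ ∘ neighbours G) (allFin n)) ≡⟨ cong sum (map-cong (λ v → length-map toℕ (neighbours G v)) (allFin n)) ⟩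
      sum (map (length ∘ neighbours G) (allFin n))    ≤⟨ sum-degrees (Unique.allFin⁺ n) (edges G) ⟩
      2 * ∣E G ∣                                      ∎
      where
      open ≤-Reasoning

    adjacencyLists-unique : All Unique (adjacencyLists ℛ G)
    adjacencyLists-unique = All.map⁺ (All.universal (λ v → Unique.map⁺ toℕ-injective (neighbours-unique G v)) (allFin n))

    length-endpoints : length (endpoints ℛ G) ≡ 2 * ∣E G ∣
    length-endpoints = go (edges G)
      where
      go : ∀ (es : List (Fin n × Fin n)) → length (concatMap (λ (a , b) → toℕ a ∷ toℕ b ∷ []) es) ≡ 2 * length es
      go []       = refl
      go (_ ∷ es) = trans (cong (2 +_) (go es)) (sym (*-suc 2 (length es)))

    length-offsets : length (offsets ℛ G) ≡ suc n
    length-offsets = trans (length-map _ (upTo (suc n))) (length-upTo (suc n))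

    nth-offsets : ∀ {i} → i < suc n → nth (offsets ℛ G) i ≡ blockStart (adjacencyLists ℛ G) i
    nth-offsets = nth-map-applyUpTo _ id

    -- The two functions agree up to index n. Beyond it the offset array reads 0, which leaves no
    -- position before the end of the block.
    offsets⇒blockStart : ∀ i {p} → InBlock (nth (offsets ℛ G)) i p → InBlock (blockStart (adjacencyLists ℛ G)) i p
    offsets⇒blockStart i (inBlock ≤p p<) with i + 1 <? suc n
    ... | yes i+1< =
      inBlock (subst (_≤ _) (nth-offsets (≤-<-trans (m≤m+n i 1) i+1<)) ≤p) (subst (_ <_) (nth-offsets i+1<) p<)
    ... | no  i+1≮ = contradiction
      (subst (_ <_) (nth-beyond (offsets ℛ G) (≤-trans (≤-reflexive length-offsets) (≮⇒≥ i+1≮))) p<) λ ()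

  read-intArray : ∀ xs i → read ℛ (intArray ℛ xs) i ≡ nth xs i
  read-intArray xs i with i <? length xs
  ... | yes i< = sym (nth-lookup xs i<)
  ... | no  i≮ = sym (nth-beyond xs (≮⇒≥ i≮))


  -- Reading and writing arrays

  module _ {s : Sort} where

    read-< : ∀ (A : Array ℛ s) {i} (i< : i < Array.size A) → read ℛ A i ≡ Array.cells A (fromℕ< i<)
    read-< (array {size} _) {i} i< with i <? size
    ... | yes _  = refl
    ... | no  i≮ = contradiction i< i≮

    size-write : ∀ (A : Array ℛ s) i x → Array.size (write ℛ A i x) ≡ Array.size A
    size-write (array {size} _) i x with i <? size
    ... | yes _ = refl
    ... | no  _ = refl

    read-write-≡ : ∀ (A : Array ℛ s) {i} x → i < Array.size A → read ℛ (write ℛ A i x) i ≡ x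
    read-write-≡ (array {size} cells) {i} x i<size with i <? size
    ... | yes i< = trans (read-< (array (Vector.updateAt cells (fromℕ< i<) (const x))) i<)
                         (updateAt-updates (fromℕ< i<) cells)
    ... | no  i≮ = contradiction i<size i≮

    read-write-≢ : ∀ (A : Array ℛ s) {i j} x → j ≢ i → read ℛ (write ℛ A i x) j ≡ read ℛ A j
    read-write-≢ (array {size} cells) {i} {j} x j≢i with i <? size
    ... | no  _ = refl
    ... | yes i< with j <? size
    ...   | yes j< = updateAt-minimal (fromℕ< j<) (fromℕ< i<) cells (j≢i ∘ fromℕ<-injective j i j< i<)
    ...   | no  _  = refl

    write-≮ : ∀ (A : Array ℛ s) {i} x → ¬ i < Array.size A → write ℛ A i x ≡ A
    write-≮ (array {size} _) {i} x i≮ with i <? size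
    ... | yes i< = contradiction i< i≮
    ... | no  _  = refl

    -- An out-of-bounds write changes nothing, so it falls under the second alternative. Marks can
    -- thus be bounded without showing that vertex numbers read from memory are below n.
    read-write : ∀ (A : Array ℛ s) i x j → read ℛ (write ℛ A i x) j ≡ x ⊎ read ℛ (write ℛ A i x) j ≡ read ℛ A j
    read-write A i x j with j ≟ i
    ... | no  j≢i  = inj₂ (read-write-≢ A x j≢i)
    ... | yes refl = by (i <? Array.size A)
      where
      by : Dec (i < Array.size A) → read ℛ (write ℛ A i x) i ≡ x ⊎ read ℛ (write ℛ A i x) i ≡ read ℛ A i
      by (yes i<) = inj₁ (read-write-≡ A x i<)
      by (no  i≮) = inj₂ (cong (λ B → read ℛ B i) (write-≮ A x i≮))

    read-zeros : ∀ m i → read ℛ {s} (array (Vector.replicate m (zeroVal ℛ s))) i ≡ zeroVal ℛ s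
    read-zeros m i with i <? m
    ... | yes _ = refl
    ... | no  _ = refl

  -- Evaluation, loop-free commands, space and unassigned registers

  modulo-< : ∀ m {n} → 0 < n → modulo ℛ m n < n
  modulo-< m {suc n} _ = m%n<n m (suc n)

  ⟦power⟧ : ∀ x m σ → ⟦_⟧ ℛ (Program.power x m) σ ≡ ⟦_⟧ ℛ x σ ^ m
  ⟦power⟧ x zero          σ = refl
  ⟦power⟧ x (suc zero)    σ = sym (*-identityʳ _)
  ⟦power⟧ x (suc (suc m)) σ = cong (⟦_⟧ ℛ x σ *_) (⟦power⟧ x (suc m) σ)

  -- On a concrete command this computes to a product of unit types, so `straight` can take it as an
  -- implicit argument filled by eta. `alloc` is excluded along with loops because its time depends
  -- on a value.
  Straight : Cmd → Set
  Straight (alloc _ _)    = ⊥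
  Straight (repeat _ _ _) = ⊥
  Straight (c ⨾ c′)       = Straight c × Straight c′
  Straight (when _ c)     = Straight c
  Straight _              = ⊤

  maxTime : Cmd → ℕ
  maxTime (_ ≔ e)        = 1 + cost ℛ e
  maxTime (_ [ e ]≔ e′)  = 1 + cost ℛ e + cost ℛ e′
  maxTime (_ ≔random e)  = 1 + cost ℛ e
  maxTime (c ⨾ c′)       = maxTime c + maxTime c′
  maxTime (when b c)     = 1 + testCost ℛ b + maxTime c
  maxTime (alloc _ _)    = 0
  maxTime (repeat _ _ _) = 0

  time≤maxTime : ∀ c → Straight c → ∀ σ → time ℛ c σ ≤ maxTime c
  time≤maxTime (_ ≔ _)       _        σ = ≤-refl
  time≤maxTime (_ [ _ ]≔ _)  _        σ = ≤-refl
  time≤maxTime (_ ≔random _) _        σ = ≤-refl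
  time≤maxTime (c ⨾ c′)      (s , s′) σ = +-mono-≤ (time≤maxTime c s σ) (time≤maxTime c′ s′ (run ℛ c σ))
  time≤maxTime (when b c)    s        σ with holds ℛ b σ
  ... | true  = +-monoʳ-≤ (1 + testCost ℛ b) (time≤maxTime c s σ)
  ... | false = +-monoʳ-≤ (1 + testCost ℛ b) z≤n

  Unassigned : Reg int → Cmd → Set
  Unassigned (reg x) (_≔_ {int} (reg y) _) = False (x Fin.≟ y)
  Unassigned (reg x) (reg y ≔random _)     = False (x Fin.≟ y)
  Unassigned x (c ⨾ c′)                    = Unassigned x c × Unassigned x c′
  Unassigned x (when _ c)                  = Unassigned x c
  Unassigned x (repeat _ _ c)              = Unassigned x c
  Unassigned x _                           = ⊤

  when-preserves : ∀ {A : Set} (f : State ℛ → A) b (g : State ℛ → State ℛ) {σ} → f (g σ) ≡ f σ → f (if b then g σ else σ) ≡ f σ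
  when-preserves f true  g eq = eq
  when-preserves f false g _  = refl

  runLoop-preserves : ∀ {A : Set} (f : State ℛ → A) b {g} → (∀ σ → f (g σ) ≡ f σ) → ∀ m σ → f (runLoop ℛ m b g σ) ≡ f σ
  runLoop-preserves f b eq zero    σ = refl
  runLoop-preserves f b {g} eq (suc m) σ with holds ℛ b σ
  ... | true  = trans (runLoop-preserves f b eq m (g σ)) (eq σ)
  ... | false = refl

  used-runLoop≤ : ∀ b c → (∀ σ → State.used (run ℛ c σ) ≤ State.used σ + time ℛ c σ) → ∀ m σ →
    State.used (runLoop ℛ m b (run ℛ c) σ) ≤ State.used σ + timeLoop ℛ m b (run ℛ c) (time ℛ c) σ
  used-runLoop≤ b c used≤ zero    σ = m≤m+n (State.used σ) 1
  used-runLoop≤ b c used≤ (suc m) σ with holds ℛ b σ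
  ... | false = m≤m+n (State.used σ) _
  ... | true  = begin
    State.used (runLoop ℛ m b (run ℛ c) (run ℛ c σ))     ≤⟨ used-runLoop≤ b c used≤ m (run ℛ c σ) ⟩
    State.used (run ℛ c σ) + rest                        ≤⟨ +-monoˡ-≤ rest (used≤ σ) ⟩
    State.used σ + time ℛ c σ + rest                     ≡⟨ +-assoc (State.used σ) (time ℛ c σ) rest ⟩
    State.used σ + (time ℛ c σ + rest)                   ≤⟨ +-monoʳ-≤ (State.used σ) (m≤n+m (time ℛ c σ + rest) (1 + testCost ℛ b)) ⟩
    State.used σ + (1 + testCost ℛ b + (time ℛ c σ + rest))  ∎
    where
    open ≤-Reasoning
    rest = timeLoop ℛ m b (run ℛ c) (time ℛ c) (run ℛ c σ)

  used≤time : ∀ c σ → State.used (run ℛ c σ) ≤ State.used σ + time ℛ c σ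
  used≤time (reg _ ≔ _)       σ = m≤m+n (State.used σ) _
  used≤time (arr _ [ _ ]≔ _)  σ = m≤m+n (State.used σ) _
  used≤time (reg _ ≔random _) σ = m≤m+n (State.used σ) _
  used≤time (alloc (arr _) e) σ = +-monoʳ-≤ (State.used σ) (m≤n+m (⟦_⟧ ℛ e σ) (1 + cost ℛ e))
  used≤time (c ⨾ c′)          σ = begin
    State.used (run ℛ c′ (run ℛ c σ))                    ≤⟨ used≤time c′ (run ℛ c σ) ⟩
    State.used (run ℛ c σ) + time ℛ c′ (run ℛ c σ)       ≤⟨ +-monoˡ-≤ _ (used≤time c σ) ⟩
    State.used σ + time ℛ c σ + time ℛ c′ (run ℛ c σ)    ≡⟨ +-assoc (State.used σ) _ _ ⟩
    State.used σ + (time ℛ c σ + time ℛ c′ (run ℛ c σ))  ∎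
    where open ≤-Reasoning
  used≤time (when b c)        σ with holds ℛ b σ
  ... | true  = ≤-trans (used≤time c σ) (+-monoʳ-≤ (State.used σ) (m≤n+m (time ℛ c σ) (1 + testCost ℛ b)))
  ... | false = m≤m+n (State.used σ) _
  used≤time (repeat e b c)    σ = ≤-trans (used-runLoop≤ b c (used≤time c) (⟦_⟧ ℛ e σ) σ)
    (+-monoʳ-≤ (State.used σ) (m≤n+m _ (1 + cost ℛ e)))

  -- A frame rule. It recovers n, k, d, t, M, s or `tail` after a whole block of commands from the
  -- syntax alone, instead of threading each of them through every invariant.
  getReg-run : ∀ x c → Unassigned x c → ∀ σ → getReg ℛ x (run ℛ c σ) ≡ getReg ℛ x σ
  getReg-run (reg x) (_≔_ {int} (reg y) _)       x≢y      σ = updateAt-minimal x y (State.regs σ int) (toWitnessFalse x≢y)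
  getReg-run (reg x) (_≔_ {real} (reg y) _)      _        σ = refl
  getReg-run (reg x) (_[_]≔_ {int} (arr _) _ _)  _        σ = refl
  getReg-run (reg x) (_[_]≔_ {real} (arr _) _ _) _        σ = refl
  getReg-run (reg x) (reg y ≔random _)           x≢y      σ = updateAt-minimal x y (State.regs σ int) (toWitnessFalse x≢y)
  getReg-run (reg x) (alloc (arr _) _)           _        σ = refl
  getReg-run r@(reg _) (c ⨾ c′)                    (u , u′) σ = trans (getReg-run r c′ u′ (run ℛ c σ)) (getReg-run r c u σ)
  getReg-run r@(reg _) (when b c)                  u        σ = when-preserves (getReg ℛ r) (holds ℛ b σ) (run ℛ c) (getReg-run r c u σ)
  getReg-run r@(reg _) (repeat e b c)              u        σ = runLoop-preserves (getReg ℛ r) b (getReg-run r c u) (⟦_⟧ ℛ e σ) σ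

  -- Time bounds

  -- A Hoare triple at a single initial state, with a time bound. Keeping the scale `N` apart from
  -- the coefficient `C` lets coefficients add up under `_then_`, while `N` may vary with the
  -- instance or the state.
  record Runs (N : ℕ) (c : Cmd) (C : ℕ) (Q : State ℛ → Set) (σ : State ℛ) : Set where
    constructor runs
    field
      time≤ : time ℛ c σ ≤ C * N
      post  : Q (run ℛ c σ)

  used-linear : ∀ c σ C D n N {Q} → Runs n c C Q σ → n ≤ N → State.used σ ≤ D * N → State.used (run ℛ c σ) ≤ (D + C) * N
  used-linear c σ C D n N (runs time≤ _) n≤N used≤ = begin
    State.used (run ℛ c σ)          ≤⟨ used≤time c σ ⟩
    State.used σ + time ℛ c σ       ≤⟨ +-mono-≤ used≤ (≤-trans time≤ (*-monoʳ-≤ C n≤N)) ⟩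
    D * N + C * N                   ≡⟨ *-distribʳ-+ N D C ⟨
    (D + C) * N                     ∎
    where open ≤-Reasoning

  module _ {N : ℕ} where

    infixr 1 _then_

    weaken : ∀ {c C Q Q′ σ} → (∀ {σ} → Q σ → Q′ σ) → Runs N c C Q σ → Runs N c C Q′ σ
    weaken Q⇒Q′ (runs time≤ post) = runs time≤ (Q⇒Q′ post)

    straight : ∀ {c Q σ} {s : Straight c} → 1 ≤ N → Q (run ℛ c σ) → Runs N c (maxTime c) Q σ
    straight {c} {σ = σ} {s} 1≤N post =
      runs (≤-trans (time≤maxTime c s σ) (subst (_≤ maxTime c * N) (*-identityʳ _) (*-monoʳ-≤ (maxTime c) 1≤N))) post

    _then_ : ∀ {c c′ C C′ P Q σ} → Runs N c C P σ → (P (run ℛ c σ) → Runs N c′ C′ Q (run ℛ c σ)) → Runs N (c ⨾ c′) (C + C′) Q σ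
    _then_ {C = C} {C′} (runs time≤ post) next with next post
    ... | runs time≤′ post′ = runs (≤-trans (+-mono-≤ time≤ time≤′) (≤-reflexive (sym (*-distribʳ-+ N C C′)))) post′

    step : ∀ {c c′ C Q σ} {s : Straight c} → 1 ≤ N → Runs N c′ C Q (run ℛ c σ) → Runs N (c ⨾ c′) (maxTime c + C) Q σ
    step {c} {s = s} 1≤N next = straight {c} {const ⊤} {s = s} 1≤N _ then λ _ → next

    -- Programs are bracketed to the right, so this splits off a prefix that has a postcondition of
    -- its own. Only the time needs regrouping; the final states agree by definition.
    assoc : ∀ {c c′ c″ C Q σ} → Runs N ((c ⨾ c′) ⨾ c″) C Q σ → Runs N (c ⨾ c′ ⨾ c″) C Q σ
    assoc {c} {c′} {c″} {C} {σ = σ} (runs time≤ post) =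
      runs (subst (_≤ C * N) (+-assoc (time ℛ c σ) (time ℛ c′ (run ℛ c σ)) (time ℛ c″ (run ℛ c′ (run ℛ c σ)))) time≤) post

    allocate : ∀ {t} {a : Arr t} {e r Q σ} → 1 ≤ N → ⟦_⟧ ℛ e σ ≤ r * N → Q (run ℛ (alloc a e) σ) →
               Runs N (alloc a e) (1 + cost ℛ e + r) Q σ
    allocate {e = e} {r} {σ = σ} 1≤N size≤ = runs (begin
      1 + cost ℛ e + ⟦_⟧ ℛ e σ        ≤⟨ +-mono-≤ (m≤m*n (1 + cost ℛ e) N {{>-nonZero 1≤N}}) size≤ ⟩
      (1 + cost ℛ e) * N + r * N    ≡⟨ *-distribʳ-+ N (1 + cost ℛ e) r ⟨
      (1 + cost ℛ e + r) * N        ∎)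
      where open ≤-Reasoning

  -- The bound `B` on the rounds is independent of the fuel `m`: the body has to show i < B whenever
  -- round i starts. For a scan, `m` is a degree and `B` is K + 1. The induction shifts `P` by one
  -- round and lowers `B` by one.
  timeLoop-bound : ∀ {b c B τ} m (P : ℕ → State ℛ → Set) →
    (∀ {i σ} → i < m → P i σ → T (holds ℛ b σ) → i < B × time ℛ c σ ≤ τ × P (suc i) (run ℛ c σ)) →
    ∀ {σ} → P 0 σ →
    timeLoop ℛ m b (run ℛ c) (time ℛ c) σ ≤ 1 + testCost ℛ b + B * (1 + testCost ℛ b + τ)
    × ∃[ i ] i ≤ m × P i (runLoop ℛ m b (run ℛ c) σ)
  timeLoop-bound zero P _ p₀ = s≤s z≤n , 0 , z≤n , p₀
  timeLoop-bound {b} {c} {B} {τ} (suc m) P body {σ} p₀ with holds ℛ b σ in eq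
  ... | false = +-monoʳ-≤ (1 + testCost ℛ b) z≤n , 0 , z≤n , p₀
  ... | true with body (s≤s z≤n) p₀ (subst T (sym eq) tt)
  -- Round 0 takes place, so B is positive; its predecessor bounds the remaining rounds.
  ...   | s≤s {n = B′} z≤n , time≤ , p₁
        with timeLoop-bound {c = c} {B = B′} m (P ∘ suc)
               (λ i< p h → let i<B , rest = body (s≤s i<) p h in ≤-pred i<B , rest) p₁
  ...     | total≤ , i , i≤m , pᵢ = (begin
    O + (time ℛ c σ + timeLoop ℛ m b (run ℛ c) (time ℛ c) (run ℛ c σ))   ≤⟨ +-monoʳ-≤ O (+-mono-≤ time≤ total≤) ⟩
    O + (τ + (O + B′ * (O + τ)))                               ≡⟨ cong (O +_) (+-assoc τ O _) ⟨
    O + (τ + O + B′ * (O + τ))                                 ≡⟨ cong (λ x → O + (x + B′ * (O + τ))) (+-comm τ O) ⟩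
    O + (O + τ + B′ * (O + τ))                                 ∎)
    , suc i , s≤s i≤m , pᵢ
    where
    open ≤-Reasoning
    O = 1 + testCost ℛ b

  -- N₁ scales the time of a round and N₂ the number of rounds.
  loop : ∀ {N N₁ N₂ B r e b c C σ₀} (P : ℕ → State ℛ → Set) → 1 ≤ N₁ → 1 ≤ N₂ → N₁ * N₂ ≤ N → B ≤ r * N₂ →
         (∀ {i σ} → i < ⟦_⟧ ℛ e σ₀ → P i σ → T (holds ℛ b σ) → i < B × Runs N₁ c C (P (suc i)) σ) → P 0 σ₀ →
         Runs N (repeat e b c) (1 + cost ℛ e + (1 + testCost ℛ b) + r * (1 + testCost ℛ b + C))
           (λ σ → ∃[ i ] i ≤ ⟦_⟧ ℛ e σ₀ × P i σ) σ₀
  loop {N} {N₁} {N₂} {B} {r} {e} {b} {c} {C} {σ₀} P 1≤N₁ 1≤N₂ N₁N₂≤N B≤ body p₀ =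
    let time≤ , post = timeLoop-bound {c = c} {τ = C * N₁} (⟦_⟧ ℛ e σ₀) P
          (λ i< p h → let i<B , runs time≤ post = body i< p h in i<B , time≤ , post) p₀
    in runs (begin
      1 + cost ℛ e + timeLoop ℛ (⟦_⟧ ℛ e σ₀) b (run ℛ c) (time ℛ c) σ₀     ≤⟨ +-monoʳ-≤ (1 + cost ℛ e) time≤ ⟩
      1 + cost ℛ e + (O + B * (O + C * N₁))                        ≡⟨ +-assoc (1 + cost ℛ e) O _ ⟨
      F + B * (O + C * N₁)                                       ≤⟨ +-mono-≤ (m≤m*n F N) (*-mono-≤ B≤ (+-monoˡ-≤ (C * N₁) (m≤m*n O N₁))) ⟩
      F * N + r * N₂ * (O * N₁ + C * N₁)                         ≡⟨ cong (λ x → F * N + r * N₂ * x) (*-distribʳ-+ N₁ O C) ⟨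
      F * N + r * N₂ * ((O + C) * N₁)                            ≡⟨ cong (F * N +_) ([m*n]*[o*p]≡[m*o]*[n*p] r N₂ (O + C) N₁) ⟩
      F * N + r * (O + C) * (N₂ * N₁)                            ≤⟨ +-monoʳ-≤ (F * N) (*-monoʳ-≤ (r * (O + C)) (≤-trans (≤-reflexive (*-comm N₂ N₁)) N₁N₂≤N)) ⟩
      F * N + r * (O + C) * N                                    ≡⟨ *-distribʳ-+ N F (r * (O + C)) ⟨
      (F + r * (O + C)) * N                                      ∎) post
    where
    open ≤-Reasoning
    O = 1 + testCost ℛ b
    F = 1 + cost ℛ e + O
    instance
      _ = >-nonZero 1≤N₁
      _ = >-nonZero (≤-trans (*-mono-≤ 1≤N₁ 1≤N₂) N₁N₂≤N)

  -- Partial breadth-first search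

  module Search (k K : ℕ) (k≤K : k ≤ K) (off : ℕ → ℕ)
    (inBlock-unique : ∀ {i j p} → InBlock off i p → InBlock off j p → i ≡ j) where

    -- What the shuffling preserves of the input lists, whatever order they end up in. `inside` is
    -- there because an out-of-bounds write is dropped, so that a swap could lose an entry.
    record Blocked (A : Array ℛ int) : Set where
      field
        inside    : ∀ {i p} → InBlock off i p → p < Array.size A
        injective : ∀ {i p q} → InBlock off i p → InBlock off i q → read ℛ A p ≡ read ℛ A q → p ≡ q

    module Swap {A : Array ℛ int} (blocked : Blocked A) {u a b} (a∈ : InBlock off u a) (b∈ : InBlock off u b) where

      open Blocked blocked
      open Transposition a b

      A′ : Array ℛ int
      A′ = write ℛ (write ℛ A a (read ℛ A b)) b (read ℛ A a)

      read-swap : ∀ j → read ℛ A′ j ≡ read ℛ A (transpose j)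
      read-swap j = by (j ≟ b) (j ≟ a)
        where
        by : Dec (j ≡ b) → Dec (j ≡ a) → read ℛ A′ j ≡ read ℛ A (transpose j)
        by (yes refl) _ = trans
          (read-write-≡ (write ℛ A a (read ℛ A b)) _ (subst (b <_) (sym (size-write A a _)) (inside b∈)))
          (cong (read ℛ A) (sym transpose-b))
        by (no j≢b) (yes refl) = trans (read-write-≢ (write ℛ A a (read ℛ A b)) _ j≢b)
          (trans (read-write-≡ A _ (inside a∈)) (cong (read ℛ A) (sym transpose-a)))
        by (no j≢b) (no j≢a) = trans (read-write-≢ (write ℛ A a (read ℛ A b)) _ j≢b)
          (trans (read-write-≢ A _ j≢a) (cong (read ℛ A) (sym (transpose-other j≢b j≢a))))

      -- A block containing `a` or `b` is block `u` by `inBlock-unique`, and that one contains both.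
      transpose-inBlock : ∀ {i j} → InBlock off i j → InBlock off i (transpose j)
      transpose-inBlock {i} {j} j∈ = by (j ≟ b) (j ≟ a)
        where
        by : Dec (j ≡ b) → Dec (j ≡ a) → InBlock off i (transpose j)
        by (yes refl) _ = subst₂ (InBlock off) (inBlock-unique b∈ j∈) (sym transpose-b) a∈
        by (no _) (yes refl) = subst₂ (InBlock off) (inBlock-unique a∈ j∈) (sym transpose-a) b∈
        by (no j≢b) (no j≢a) = subst (InBlock off i) (sym (transpose-other j≢b j≢a)) j∈

      swap-blocked : Blocked A′
      swap-blocked = record
        { inside    = λ p∈ → subst (_ <_)
            (sym (trans (size-write (write ℛ A a (read ℛ A b)) b _) (size-write A a _))) (inside p∈)
        ; injective = λ {i} {p} {q} p∈ q∈ eq → transpose-injective (injective (transpose-inBlock p∈) (transpose-inBlock q∈)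
            (trans (sym (read-swap p)) (trans eq (read-swap q))))
        }

    -- Stated for the values it concerns and not for a state, as are the invariants that follow:
    -- assignments to other registers and arrays then leave the proposition definitionally
    -- unchanged, and its proof can be reused as it is.
    record Ready (kʳ : ℕ) (offset adjacent : Array ℛ int) : Set where
      constructor ready
      field
        k≡      : kʳ ≡ k
        offset≡ : ∀ i → read ℛ offset i ≡ off i
        blocked : Blocked adjacent

    Queued : Array ℛ int → ℕ → ℕ → Set
    Queued queue tail w = ∃[ q ] q < tail × read ℛ queue q ≡ w

    -- `marked` is the heart of it: whatever carries the current mark is in the queue. A visit
    -- raises both M and `tail` by one; the extra 1 in `M-bound` accounts for v itself, which is
    -- queued without giving an edge.
    record Searching (v tail M : ℕ) (queue mark : Array ℛ int) : Set where
      field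
        queue-size : Array.size queue ≡ k + 1
        tail≤      : tail ≤ k + 1
        mark≤      : ∀ w → read ℛ mark w ≤ v + 1
        marked     : ∀ w → read ℛ mark w ≡ v + 1 → Queued queue tail w
        M-bound    : M + 1 ≤ v * k + tail

    module Visit {v tail M queue mark} (searching : Searching v tail M queue mark) (tail< : tail < k + 1) (w : ℕ) where

      open Searching searching

      queue′ : Array ℛ int
      queue′ = write ℛ queue tail w

      queued-w : Queued queue′ (tail + 1) w
      queued-w = tail , m<m+n tail (s≤s z≤n) , read-write-≡ queue w (subst (tail <_) (sym queue-size) tail<)

      queued-old : ∀ {x} → Queued queue tail x → Queued queue′ (tail + 1) x
      queued-old (q , q<tail , eq) = q , <-≤-trans q<tail (m≤m+n tail 1) , trans (read-write-≢ queue w (<⇒≢ q<tail)) eq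

      visited : Searching v (tail + 1) (M + 1) queue′ (write ℛ mark w (v + 1))
      visited = record
        { queue-size = trans (size-write queue tail w) queue-size
        ; tail≤      = subst (_≤ k + 1) (+-comm 1 tail) tail<
        ; mark≤      = mark≤′
        ; marked     = marked′
        ; M-bound    = subst (M + 1 + 1 ≤_) (+-assoc (v * k) tail 1) (+-monoˡ-≤ 1 M-bound)
        }
        where
        mark≤′ : ∀ x → read ℛ (write ℛ mark w (v + 1)) x ≤ v + 1
        mark≤′ x with read-write mark w (v + 1) x
        ... | inj₁ eq = ≤-reflexive eq
        ... | inj₂ eq = subst (_≤ v + 1) (sym eq) (mark≤ x)
        marked′ : ∀ x → read ℛ (write ℛ mark w (v + 1)) x ≡ v + 1 → Queued queue′ (tail + 1) x
        marked′ x eq with x ≟ w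
        ... | yes refl = queued-w
        ... | no  x≢w  = queued-old (marked x (trans (sym (read-write-≢ mark _ x≢w)) eq))

    -- i entries of the list of u have been read.
    record Frontier (u i : ℕ) (uʳ lo tail : ℕ) (adjacent queue : Array ℛ int) : Set where
      field
        u≡      : uʳ ≡ u
        lo≡     : lo ≡ off u + i
        scanned : ∀ {p} → off u ≤ p → p < off u + i → Queued queue tail (read ℛ adjacent p)

    -- The scanned entries of a block are distinct, so there are at most as many
    -- as there are entries of the queue.
    frontier≤tail : ∀ {u i uʳ lo tail adjacent queue} → Blocked adjacent → Frontier u i uʳ lo tail adjacent queue →
                    off u + i ≤ off (u + 1) → i ≤ tail
    frontier≤tail {u} {i} {tail = tail} {adjacent} {queue} blocked frontier end≤ = injective⇒≤ {f = position} λ {j} {j′} eq →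
      toℕ-injective (+-cancelˡ-≡ (off u) _ _ (Blocked.injective blocked (∈block j) (∈block j′)
        (trans (sym (found j)) (trans (cong (read ℛ queue) (fromℕ<-injective _ _ (bound j) (bound j′) eq)) (found j′)))))
      where
      open Frontier frontier
      <end : ∀ (j : Fin i) → off u + toℕ j < off u + i
      <end j = +-monoʳ-< (off u) (toℕ<n j)
      ∈block : ∀ (j : Fin i) → InBlock off u (off u + toℕ j)
      ∈block j = inBlock (m≤m+n (off u) (toℕ j)) (<-≤-trans (<end j) end≤)
      entry : ∀ (j : Fin i) → Queued queue tail (read ℛ adjacent (off u + toℕ j))
      entry j = scanned (m≤m+n (off u) (toℕ j)) (<end j)
      bound : ∀ j → proj₁ (entry j) < tail
      bound j = proj₁ (proj₂ (entry j))
      found : ∀ j → read ℛ queue (proj₁ (entry j)) ≡ read ℛ adjacent (off u + toℕ j)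
      found j = proj₂ (proj₂ (entry j))
      position : Fin i → Fin tail
      position j = fromℕ< (bound j)

    -- Scanning one adjacency list

    IsReady : State ℛ → Set
    IsReady σ = Ready (getReg ℛ Program.k σ) (getArr ℛ Program.offset σ) (getArr ℛ Program.adjacent σ)

    IsSearching : State ℛ → Set
    IsSearching σ = Searching (getReg ℛ Program.v σ) (getReg ℛ Program.tail σ) (getReg ℛ Program.M σ)
      (getArr ℛ Program.queue σ) (getArr ℛ Program.mark σ)

    record InSearch (v : ℕ) (σ : State ℛ) : Set where
      constructor inSearch
      field
        v≡        : getReg ℛ Program.v σ ≡ v
        isReady     : IsReady σ
        isSearching : IsSearching σ

    IsFrontier : ℕ → ℕ → State ℛ → Set
    IsFrontier u i σ = Frontier u i (getReg ℛ Program.u σ) (getReg ℛ Program.lo σ) (getReg ℛ Program.tail σ)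
      (getArr ℛ Program.adjacent σ) (getArr ℛ Program.queue σ)

    record InScan (v u i : ℕ) (σ : State ℛ) : Set where
      constructor inScan
      field
        search      : InSearch v σ
        isFrontier : IsFrontier u i σ

    when-post : ∀ (Q : State ℛ → Set) b c σ →
      (T (holds ℛ b σ) → Q (run ℛ c σ)) → (¬ T (holds ℛ b σ) → Q σ) → Q (run ℛ (when b c) σ)
    when-post Q b c σ q₁ q₂ with holds ℛ b σ
    ... | true  = q₁ tt
    ... | false = q₂ id

    -- The part of `scan-body` before the test of the mark, bracketed to the left so that four uses
    -- of `assoc` recover `scan-body`.
    take-next : Cmd
    take-next =
      (((Program.p ≔random Program.offset [ ! Program.u ⊕ lit 1 ] ⊖ ! Program.lo ⨾
      Program.p ≔ ! Program.lo ⊕ ! Program.p) ⨾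
      Program.swap Program.adjacent Program.lo Program.p) ⨾
      Program.w ≔ Program.adjacent [ ! Program.lo ]) ⨾
      Program.lo ≔ ! Program.lo ⊕ lit 1

    -- Here `lo` has already moved past entry `off u + i`, while `scanned` still stops short of it;
    -- a visit or a skip closes this gap.
    record Taken (v u i : ℕ) (σ : State ℛ) : Set where
      field
        search    : InSearch v σ
        u≡       : getReg ℛ Program.u σ ≡ u
        lo≡      : getReg ℛ Program.lo σ ≡ off u + suc i
        w≡       : getReg ℛ Program.w σ ≡ read ℛ (getArr ℛ Program.adjacent σ) (off u + i)
        scanned  : ∀ {p} → off u ≤ p → p < off u + i →
                   Queued (getArr ℛ Program.queue σ) (getReg ℛ Program.tail σ) (read ℛ (getArr ℛ Program.adjacent σ) p)

    -- The draw is below hi - lo, so both swapped positions lie in the unread rest of the block of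
    -- u: entries read before stay in place, and `Blocked` survives.
    taken : ∀ {v u i σ} → InScan v u i σ → off u + i < off (u + 1) → Taken v u i (run ℛ take-next σ)
    taken {v} {u} {i} {σ} (inScan (inSearch v≡ (ready k≡ offset≡ blocked) searching) frontier) next< = record
      { search = inSearch v≡ (ready k≡ offset≡ swap-blocked) searching
      ; u≡ = u≡
      ; lo≡ = trans (cong (_+ 1) lo≡) (trans (+-assoc (off u) i 1) (cong (off u +_) (+-comm i 1)))
      ; w≡ = cong (read ℛ A′) lo≡
      ; scanned = scanned′
      }
      where
      open Frontier frontier
      A = getArr ℛ Program.adjacent σ
      lo = getReg ℛ Program.lo σ
      hi = read ℛ (getArr ℛ Program.offset σ) (getReg ℛ Program.u σ + 1)
      r = modulo ℛ (State.coins σ 0) (hi ∸ lo)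
      hi≡ : hi ≡ off (u + 1)
      hi≡ = trans (offset≡ _) (cong (λ x → off (x + 1)) u≡)
      lo<hi : lo < hi
      lo<hi = subst₂ _<_ (sym lo≡) (sym hi≡) next<
      off≤lo : off u ≤ lo
      off≤lo = subst (off u ≤_) (sym lo≡) (m≤m+n (off u) i)
      lo∈ : InBlock off u lo
      lo∈ = inBlock off≤lo (subst (lo <_) hi≡ lo<hi)
      p∈ : InBlock off u (lo + r)
      p∈ = inBlock (≤-trans off≤lo (m≤m+n lo r))
        (subst (lo + r <_) hi≡ (i<n∸m⇒m+i<n hi lo (modulo-< (State.coins σ 0) (m<n⇒0<n∸m lo<hi))))
      open Swap blocked lo∈ p∈
      open Transposition lo (lo + r)
      unmoved : ∀ {p} → p < off u + i → read ℛ A′ p ≡ read ℛ A p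
      unmoved {p} p< = trans (read-swap p) (cong (read ℛ A) (transpose-other (<⇒≢ (<-≤-trans p<lo (m≤m+n lo r))) (<⇒≢ p<lo)))
        where
        p<lo : p < lo
        p<lo = subst (p <_) (sym lo≡) p<
      scanned′ : ∀ {p} → off u ≤ p → p < off u + i → Queued (getArr ℛ Program.queue σ) (getReg ℛ Program.tail σ) (read ℛ A′ p)
      scanned′ ≤p p< = subst (Queued (getArr ℛ Program.queue σ) (getReg ℛ Program.tail σ)) (sym (unmoved p<)) (scanned ≤p p<)

    scanned-suc : ∀ {u i tail} {adjacent queue : Array ℛ int} →
      (∀ {p} → off u ≤ p → p < off u + i → Queued queue tail (read ℛ adjacent p)) →
      Queued queue tail (read ℛ adjacent (off u + i)) →
      ∀ {p} → off u ≤ p → p < off u + suc i → Queued queue tail (read ℛ adjacent p)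
    scanned-suc {u} {i} old new {p} ≤p p< with p ≟ off u + i
    ... | yes refl = new
    ... | no  p≢   = old ≤p (≤∧≢⇒< (≤-pred (subst (p <_) (+-suc (off u) i) p<)) p≢)

    enqueue : Cmd
    enqueue =
      Program.mark [ ! Program.w ]≔ ! Program.v ⊕ lit 1 ⨾
      Program.queue [ ! Program.tail ]≔ ! Program.w ⨾
      Program.level [ ! Program.tail ]≔ ! Program.l ⊕ lit 1 ⨾
      Program.source [ ! Program.M ]≔ ! Program.v ⨾
      Program.target [ ! Program.M ]≔ ! Program.w ⨾
      Program.distance [ ! Program.M ]≔ ! Program.l ⊕ lit 1 ⨾
      Program.M ≔ ! Program.M ⊕ lit 1

    -- The two branches differ only in the write to ρ, which the invariant does not mention, so the
    -- same proof serves both.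
    visit-step : ∀ {v u i σ} → Taken v u i σ → getReg ℛ Program.tail σ < k + 1 → InScan v u (suc i) (run ℛ Program.visit σ)
    visit-step {v} {u} {i} {σ} t tail< =
      when-post (λ σ → InScan v u (suc i) (run ℛ (Program.tail ≔ ! Program.tail ⊕ lit 1) σ))
        (! Program.tail ≐ lit 1) (Program.ρ [ ! Program.v ]≔ toReal (! Program.l ⊕ lit 1)) (run ℛ enqueue σ)
        (λ _ → after₁) (λ _ → after₂)
      where
      open Taken t
      open InSearch search
      queue = getArr ℛ Program.queue σ
      tail = getReg ℛ Program.tail σ
      adjacent = getArr ℛ Program.adjacent σ
      open Visit isSearching tail< (getReg ℛ Program.w σ)
      queued-next : Queued queue′ (tail + 1) (read ℛ adjacent (off u + i))
      queued-next = subst (Queued queue′ (tail + 1)) w≡ queued-w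
      scanned′ : ∀ {p} → off u ≤ p → p < off u + i → Queued queue′ (tail + 1) (read ℛ adjacent p)
      scanned′ ≤p p< = queued-old (scanned ≤p p<)
      frontier : Frontier u (suc i) (getReg ℛ Program.u σ) (getReg ℛ Program.lo σ) (tail + 1) adjacent queue′
      frontier = record { u≡ = u≡ ; lo≡ = lo≡ ; scanned = scanned-suc {u} {i} {tail + 1} {adjacent} {queue′} scanned′ queued-next }
      after₁ : InScan v u (suc i) (run ℛ (Program.tail ≔ ! Program.tail ⊕ lit 1)
        (run ℛ (Program.ρ [ ! Program.v ]≔ toReal (! Program.l ⊕ lit 1)) (run ℛ enqueue σ)))
      after₁ = inScan (inSearch v≡ isReady visited) frontier
      after₂ : InScan v u (suc i) (run ℛ (Program.tail ≔ ! Program.tail ⊕ lit 1) (run ℛ enqueue σ))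
      after₂ = inScan (inSearch v≡ isReady visited) frontier

    -- A skip uses up a round without lengthening the queue. It is harmless because `marked` places
    -- the entry in the queue already.
    skip-step : ∀ {v u i σ} → Taken v u i σ →
      read ℛ (getArr ℛ Program.mark σ) (getReg ℛ Program.w σ) ≡ getReg ℛ Program.v σ + 1 → InScan v u (suc i) σ
    skip-step {v} {u} {i} {σ} t marked-w = inScan search (record { u≡ = u≡ ; lo≡ = lo≡ ; scanned = scanned′ })
      where
      open Taken t
      queue = getArr ℛ Program.queue σ
      tail = getReg ℛ Program.tail σ
      adjacent = getArr ℛ Program.adjacent σ
      queued-w : Queued queue tail (getReg ℛ Program.w σ)
      queued-w = Searching.marked (InSearch.isSearching search) (getReg ℛ Program.w σ) marked-w
      scanned′ : ∀ {p} → off u ≤ p → p < off u + suc i → Queued queue tail (read ℛ adjacent p)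
      scanned′ = scanned-suc {u} {i} {tail} {adjacent} {queue} scanned (subst (Queued queue tail) w≡ queued-w)

    scan-body : Cmd
    scan-body =
      Program.p ≔random Program.offset [ ! Program.u ⊕ lit 1 ] ⊖ ! Program.lo ⨾
      Program.p ≔ ! Program.lo ⊕ ! Program.p ⨾
      Program.swap Program.adjacent Program.lo Program.p ⨾
      Program.w ≔ Program.adjacent [ ! Program.lo ] ⨾
      Program.lo ≔ ! Program.lo ⊕ lit 1 ⨾
      when (not (Program.mark [ ! Program.w ] ≐ ! Program.v ⊕ lit 1)) Program.visit

    ¬T-not : ∀ {b} → ¬ T (Data.Bool.not b) → T b
    ¬T-not {true}  _  = tt
    ¬T-not {false} ¬⊤ = ¬⊤ tt

    visit-or-skip : ∀ {v u i σ} → Taken v u i σ → getReg ℛ Program.tail σ < k + 1 →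
                    InScan v u (suc i) (run ℛ (when (not (Program.mark [ ! Program.w ] ≐ ! Program.v ⊕ lit 1)) Program.visit) σ)
    visit-or-skip {v} {u} {i} {σ} t tail< =
      when-post (InScan v u (suc i)) (not (Program.mark [ ! Program.w ] ≐ ! Program.v ⊕ lit 1)) Program.visit σ
        (λ _ → visit-step t tail<)
        (λ ¬unmarked → skip-step t
          (≡ᵇ⇒≡ (read ℛ (getArr ℛ Program.mark σ) (getReg ℛ Program.w σ)) (getReg ℛ Program.v σ + 1) (¬T-not ¬unmarked)))

    take-next-runs : ∃[ C ] ∀ {v u i σ} → InScan v u i σ → off u + i < off (u + 1) →
                     Runs 1 take-next C (Taken v u i) σ
    take-next-runs = _ , λ {v} {u} {i} {σ} inv next< → straight ≤-refl (taken {v} {u} {i} {σ} inv next<)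

    visit-or-skip-runs : ∃[ C ] ∀ {v u i σ} → Taken v u i σ → getReg ℛ Program.tail σ < k + 1 →
      Runs 1 (when (not (Program.mark [ ! Program.w ] ≐ ! Program.v ⊕ lit 1)) Program.visit) C (InScan v u (suc i)) σ
    visit-or-skip-runs = _ , λ {v} {u} {i} {σ} t tail< → straight ≤-refl (visit-or-skip {v} {u} {i} {σ} t tail<)

    scan-body-runs : ∃[ C ] ∀ {v u i σ} → InScan v u i σ → off u + i < off (u + 1) → getReg ℛ Program.tail σ < k + 1 →
                     Runs 1 scan-body C (InScan v u (suc i)) σ
    scan-body-runs = _ , λ {v} {u} {i} {σ} inv next< tail< →
      assoc (assoc (assoc (assoc
        (proj₂ take-next-runs {v} {u} {i} {σ} inv next< then
          λ t → proj₂ visit-or-skip-runs {v} {u} {i} {run ℛ take-next σ} t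
            (subst (_< k + 1) (sym (getReg-run Program.tail take-next _ σ)) tail<)))))

    fuel : Exp int
    fuel = Program.offset [ ! Program.u ⊕ lit 1 ] ⊖ ! Program.lo

    scan-loop-runs : ∃[ C ] ∀ {v σ} → InSearch v σ →
      getReg ℛ Program.lo σ ≡ read ℛ (getArr ℛ Program.offset σ) (getReg ℛ Program.u σ) →
      Runs 1 (repeat fuel (! Program.tail ≺ ! Program.k ⊕ lit 1) scan-body) C (InSearch v) σ
    scan-loop-runs = _ , λ {v} {σ} inv lo≡ →
      let open Ready (InSearch.isReady inv)
          u  = getReg ℛ Program.u σ
          hi≡ = offset≡ (u + 1)
          lo≡off = trans lo≡ (offset≡ u)
          next< : ∀ {i} → i < ⟦_⟧ ℛ fuel σ → off u + i < off (u + 1)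
          next< {i} i< = i<n∸m⇒m+i<n (off (u + 1)) (off u) (subst₂ (λ x y → i < x ∸ y) hi≡ lo≡off i<)
          start : InScan v u 0 σ
          start = inScan inv (record
            { u≡ = refl ; lo≡ = trans lo≡off (sym (+-identityʳ (off u)))
            ; scanned = λ {p} ≤p p< → contradiction (subst (p <_) (+-identityʳ (off u)) p<) (≤⇒≯ ≤p) })
          round : ∀ {i σ′} → i < ⟦_⟧ ℛ fuel σ → InScan v u i σ′ → T (holds ℛ (! Program.tail ≺ ! Program.k ⊕ lit 1) σ′) →
                  i < K + 1 × Runs 1 scan-body (proj₁ scan-body-runs) (InScan v u (suc i)) σ′
          round {i} {σ′} i< inv′ h =
            let tail< = subst (λ x → getReg ℛ Program.tail σ′ < x + 1) (Ready.k≡ (InSearch.isReady (InScan.search inv′)))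
                          (<ᵇ⇒< (getReg ℛ Program.tail σ′) (getReg ℛ Program.k σ′ + 1) h)
            -- i ≤ tail holds by counting, and tail < k + 1 by the loop test, so i < K + 1 whatever
            -- the length of the block.
            in ≤-<-trans (frontier≤tail (Ready.blocked (InSearch.isReady (InScan.search inv′))) (InScan.isFrontier inv′) (<⇒≤ (next< i<)))
                 (<-≤-trans tail< (+-monoˡ-≤ 1 k≤K))
             , proj₂ scan-body-runs inv′ (next< i<) tail<
      in weaken (λ { (_ , _ , inScan search _) → search })
           (loop {N₁ = 1} {N₂ = 1} {B = K + 1} {r = K + 1} {e = fuel} (InScan v u) ≤-refl ≤-refl ≤-refl
             (≤-reflexive (sym (*-identityʳ (K + 1)))) round start)

    -- A whole scan and a whole search

    enter : Cmd
    enter =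
      (Program.u ≔ Program.queue [ ! Program.head ] ⨾
      Program.l ≔ Program.level [ ! Program.head ]) ⨾
      Program.lo ≔ Program.offset [ ! Program.u ]

    record Entered (v : ℕ) (σ : State ℛ) : Set where
      field
        search : InSearch v σ
        lo≡    : getReg ℛ Program.lo σ ≡ read ℛ (getArr ℛ Program.offset σ) (getReg ℛ Program.u σ)

    entered : ∀ {v} σ → InSearch v σ → Entered v (run ℛ enter σ)
    entered σ (inSearch v≡ isReady isSearching) = record { search = inSearch v≡ isReady isSearching ; lo≡ = refl }

    enter-runs : ∃[ C ] ∀ {v σ} → InSearch v σ → Runs 1 enter C (Entered v) σ
    enter-runs = _ , λ {v} {σ} inv → straight ≤-refl (entered {v} σ inv)

    leave : Cmd
    leave = Program.head ≔ ! Program.head ⊕ lit 1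

    left : ∀ {v} σ → InSearch v σ → InSearch v (run ℛ leave σ)
    left σ (inSearch v≡ isReady isSearching) = inSearch v≡ isReady isSearching

    leave-runs : ∃[ C ] ∀ {v σ} → InSearch v σ → Runs 1 leave C (InSearch v) σ
    leave-runs = _ , λ {v} {σ} inv → straight ≤-refl (left {v} σ inv)

    scan-runs : ∃[ C ] ∀ {v σ} → InSearch v σ → Runs 1 Program.scan C (InSearch v) σ
    scan-runs = _ , λ inv → assoc (assoc (proj₂ enter-runs inv then λ e →
      proj₂ scan-loop-runs (Entered.search e) (Entered.lo≡ e) then proj₂ leave-runs))

    -- The state after the searches from 0, ..., v - 1. All marks are at most v, so v + 1 is a fresh
    -- mark for the next search.
    record Between (v : ℕ) (σ : State ℛ) : Set where
      field
        v≡         : getReg ℛ Program.v σ ≡ v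
        isReady    : IsReady σ
        queue-size : Array.size (getArr ℛ Program.queue σ) ≡ k + 1
        mark≤      : ∀ w → read ℛ (getArr ℛ Program.mark σ) w ≤ getReg ℛ Program.v σ
        M-bound    : getReg ℛ Program.M σ ≤ v * k

    begin-search : Cmd
    begin-search =
      (((Program.mark [ ! Program.v ]≔ ! Program.v ⊕ lit 1 ⨾
      Program.queue [ lit 0 ]≔ ! Program.v) ⨾
      Program.level [ lit 0 ]≔ lit 0) ⨾
      Program.head ≔ lit 0) ⨾
      Program.tail ≔ lit 1

    begin-step : ∀ {v σ} → Between v σ → InSearch v (run ℛ begin-search σ)
    begin-step {v} {σ} between = inSearch v≡ isReady searching
      where
      open Between between
      mark = getArr ℛ Program.mark σ
      queue = getArr ℛ Program.queue σ
      vʳ = getReg ℛ Program.v σ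
      mark≤′ : ∀ w → read ℛ (write ℛ mark vʳ (vʳ + 1)) w ≤ vʳ + 1
      mark≤′ w with read-write mark vʳ (vʳ + 1) w
      ... | inj₁ eq = ≤-reflexive eq
      ... | inj₂ eq = subst (_≤ vʳ + 1) (sym eq) (≤-trans (mark≤ w) (m≤m+n vʳ 1))
      marked′ : ∀ w → read ℛ (write ℛ mark vʳ (vʳ + 1)) w ≡ vʳ + 1 → Queued (write ℛ queue 0 vʳ) 1 w
      marked′ w eq with w ≟ vʳ
      -- The queue has k + 1 cells, so the write to cell 0 takes effect even for k = 0.
      ... | yes refl = 0 , s≤s z≤n , read-write-≡ queue vʳ (subst (0 <_) (sym (trans queue-size (+-comm k 1))) (s≤s z≤n))
      ... | no  w≢v  = contradiction
        (subst (_≤ vʳ) (trans (sym (read-write-≢ mark (vʳ + 1) w≢v)) eq) (mark≤ w)) (<⇒≱ (m<m+n vʳ (s≤s z≤n)))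
      searching : Searching vʳ 1 (getReg ℛ Program.M σ) (write ℛ queue 0 vʳ) (write ℛ mark vʳ (vʳ + 1))
      searching = record
        { queue-size = trans (size-write queue 0 vʳ) queue-size
        ; tail≤ = m≤n+m 1 k
        ; mark≤ = mark≤′
        ; marked = marked′
        ; M-bound = +-monoˡ-≤ 1 (subst (λ x → getReg ℛ Program.M σ ≤ x * k) (sym v≡) M-bound)
        }

    end-step : ∀ {v σ} → InSearch v σ → Between (suc v) (run ℛ (Program.v ≔ ! Program.v ⊕ lit 1) σ)
    end-step {v} {σ} (inSearch v≡ isReady isSearching) = record
      { v≡ = trans (cong (_+ 1) v≡) (+-comm v 1)
      ; isReady = isReady
      ; queue-size = queue-size
      ; mark≤ = mark≤
      ; M-bound = M≤
      }
      where
      open Searching isSearching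
      open ≤-Reasoning
      M≤ : getReg ℛ Program.M σ ≤ suc v * k
      M≤ = +-cancelʳ-≤ 1 _ _ (begin
        getReg ℛ Program.M σ + 1                       ≤⟨ M-bound ⟩
        getReg ℛ Program.v σ * k + getReg ℛ Program.tail σ     ≤⟨ +-mono-≤ (≤-reflexive (cong (_* k) v≡)) tail≤ ⟩
        v * k + (k + 1)                        ≡⟨ +-assoc (v * k) k 1 ⟨
        v * k + k + 1                          ≡⟨ cong (_+ 1) (+-comm (v * k) k) ⟩
        suc v * k + 1                          ∎)

    begin-search-runs : ∃[ C ] ∀ {v σ} → Between v σ → Runs 1 begin-search C (InSearch v) σ
    begin-search-runs = _ , λ {v} {σ} between → straight ≤-refl (begin-step {v} {σ} between)

    search-runs : ∃[ C ] ∀ {v σ} → Between v σ → Runs 1 Program.search C (InSearch v) σ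
    search-runs = _ , λ {v} between →
      assoc (assoc (assoc (assoc (proj₂ begin-search-runs between then λ inv₀ →
        weaken (λ (_ , _ , inv) → inv)
          (loop {N₁ = 1} {N₂ = 1} {B = K} {r = K} (λ _ → InSearch v) ≤-refl ≤-refl ≤-refl (≤-reflexive (sym (*-identityʳ K)))
            (λ i< inv _ → <-≤-trans i< (≤-trans (≤-reflexive (Ready.k≡ (InSearch.isReady inv₀))) k≤K) , proj₂ scan-runs inv)
            inv₀)))))

    end-search-runs : ∃[ C ] ∀ {v σ} → InSearch v σ → Runs 1 (Program.v ≔ ! Program.v ⊕ lit 1) C (Between (suc v)) σ
    end-search-runs = _ , λ {v} {σ} inv → straight ≤-refl (end-step {v} {σ} inv)

    search-all-runs : ∃[ C ] ∀ {n σ} → 1 ≤ n → getReg ℛ Program.n σ ≡ n → Between 0 σ →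
      Runs n (repeat (! Program.n) always (Program.search ⨾ Program.v ≔ ! Program.v ⊕ lit 1)) C
        (λ σ′ → getReg ℛ Program.M σ′ ≤ n * k) σ
    search-all-runs = _ , λ {n} 1≤n n≡ between →
      weaken (λ (i , i≤ , b) → ≤-trans (Between.M-bound b) (*-monoˡ-≤ k (≤-trans i≤ (≤-reflexive n≡))))
        (loop {N₁ = 1} {N₂ = n} {B = n} {r = 1} Between ≤-refl 1≤n (≤-reflexive (*-identityˡ n)) (≤-reflexive (sym (*-identityˡ n)))
          (λ i< b _ → <-≤-trans i< (≤-reflexive n≡) , (proj₂ search-runs b then proj₂ end-search-runs)) between)

    -- Allocation of the work space and the complete search phase

    module _ {n : ℕ} (1≤n : 1 ≤ n) where

      instance
        n≢0 : NonZero n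
        n≢0 = >-nonZero 1≤n

      record Prepared (nʳ kʳ : ℕ) (offset adjacent mark queue : Array ℛ int) : Set where
        field
          n≡         : nʳ ≡ n
          isReady    : Ready kʳ offset adjacent
          mark≡0     : ∀ w → read ℛ mark w ≡ 0
          queue-size : Array.size queue ≡ k + 1

      IsPrepared : State ℛ → Set
      IsPrepared σ = Prepared (getReg ℛ Program.n σ) (getReg ℛ Program.k σ)
        (getArr ℛ Program.offset σ) (getArr ℛ Program.adjacent σ) (getArr ℛ Program.mark σ) (getArr ℛ Program.queue σ)

      n*k≤ : ∀ {nʳ kʳ} → nʳ ≡ n → kʳ ≡ k → nʳ * kʳ ≤ K * n
      n*k≤ refl refl = ≤-trans (*-monoʳ-≤ n k≤K) (≤-reflexive (*-comm n K))

      k+1≤ : ∀ {kʳ} → kʳ ≡ k → kʳ + 1 ≤ (K + 1) * n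
      k+1≤ refl = ≤-trans (+-monoˡ-≤ 1 k≤K) (m≤m*n (K + 1) n)

      n≤ : ∀ {nʳ} → nʳ ≡ n → nʳ ≤ 1 * n
      n≤ refl = ≤-reflexive (sym (*-identityˡ n))

      alloc-mark-queue : Cmd
      alloc-mark-queue = alloc Program.mark (! Program.n) ⨾ alloc Program.queue (! Program.k ⊕ lit 1)

      alloc-mark-queue-runs : ∃[ C ] ∀ {σ} → getReg ℛ Program.n σ ≡ n → IsReady σ → Runs n alloc-mark-queue C IsPrepared σ
      alloc-mark-queue-runs = _ , λ {σ} n≡ isReady →
        allocate {r = 1} {Q = λ _ → ⊤} 1≤n (n≤ n≡) _ then λ _ →
          allocate {r = K + 1} 1≤n (k+1≤ (Ready.k≡ isReady)) (record
            { n≡ = n≡ ; isReady = isReady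
            ; mark≡0 = read-zeros {int} (getReg ℛ Program.n σ)
            ; queue-size = cong (_+ 1) (Ready.k≡ isReady) })

      alloc-level-runs : ∃[ C ] ∀ {σ} → IsPrepared σ → Runs n (alloc Program.level (! Program.k ⊕ lit 1)) C IsPrepared σ
      alloc-level-runs = _ , λ {σ} p → allocate {r = K + 1} 1≤n (k+1≤ (Ready.k≡ (Prepared.isReady p))) p

      alloc-source-runs : ∃[ C ] ∀ {σ} → IsPrepared σ → Runs n (alloc Program.source (! Program.n ⊗ ! Program.k)) C IsPrepared σ
      alloc-source-runs = _ , λ {σ} p → allocate {r = K} 1≤n (n*k≤ (Prepared.n≡ p) (Ready.k≡ (Prepared.isReady p))) p

      alloc-target-runs : ∃[ C ] ∀ {σ} → IsPrepared σ → Runs n (alloc Program.target (! Program.n ⊗ ! Program.k)) C IsPrepared σ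
      alloc-target-runs = _ , λ {σ} p → allocate {r = K} 1≤n (n*k≤ (Prepared.n≡ p) (Ready.k≡ (Prepared.isReady p))) p

      alloc-distance-runs : ∃[ C ] ∀ {σ} → IsPrepared σ → Runs n (alloc Program.distance (! Program.n ⊗ ! Program.k)) C IsPrepared σ
      alloc-distance-runs = _ , λ {σ} p → allocate {r = K} 1≤n (n*k≤ (Prepared.n≡ p) (Ready.k≡ (Prepared.isReady p))) p

      alloc-ρ-runs : ∃[ C ] ∀ {σ} → IsPrepared σ → Runs n (alloc Program.ρ (! Program.n)) C IsPrepared σ
      alloc-ρ-runs = _ , λ {σ} p → allocate {r = 1} 1≤n (n≤ (Prepared.n≡ p)) p

      reset : Cmd
      reset = Program.M ≔ lit 0 ⨾ Program.v ≔ lit 0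

      reset-between : ∀ σ → IsPrepared σ → Between 0 (run ℛ reset σ)
      reset-between σ p = record
        { v≡ = refl ; isReady = isReady ; queue-size = queue-size
        ; mark≤ = λ w → ≤-reflexive (mark≡0 w) ; M-bound = z≤n }
        where open Prepared p

      reset-runs : ∃[ C ] ∀ {σ} → getReg ℛ Program.n σ ≡ n → IsPrepared σ →
                   Runs n reset C (λ σ′ → getReg ℛ Program.n σ′ ≡ n × Between 0 σ′) σ
      reset-runs = _ , λ {σ} n≡ p → straight 1≤n (n≡ , reset-between σ p)

      partialBFS-runs : ∃[ C ] ∀ {σ} → getReg ℛ Program.n σ ≡ n → IsReady σ →
                        Runs n Program.partialBFS C (λ σ′ → getReg ℛ Program.M σ′ ≤ K * n) σ
      partialBFS-runs = _ , λ n≡ isReady →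
        assoc (proj₂ alloc-mark-queue-runs n≡ isReady then λ p →
        proj₂ alloc-level-runs p then λ p →
        proj₂ alloc-source-runs p then λ p →
        proj₂ alloc-target-runs p then λ p →
        proj₂ alloc-distance-runs p then λ p →
        proj₂ alloc-ρ-runs p then λ p →
        assoc (proj₂ reset-runs (Prepared.n≡ p) p then λ (n≡ , between) →
        weaken (λ M≤ → ≤-trans M≤ (n*k≤ refl refl)) (proj₂ search-all-runs 1≤n n≡ between)))
  -- Edge weights and gradient descent

  module Descent (K d : ℕ) where

    rescale : ∀ {N N′ r c C Q σ} → N ≤ r * N′ → Runs N c C Q σ → Runs N′ c (C * r) Q σ
    rescale {N} {N′} {r} {C = C} N≤ (runs time≤ post) =
      runs (≤-trans time≤ (≤-trans (*-monoʳ-≤ C N≤) (≤-reflexive (sym (*-assoc C r N′))))) post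

    linear-loop : ∀ {n r e b c C σ₀} (P : ℕ → State ℛ → Set) → 1 ≤ n → ⟦_⟧ ℛ e σ₀ ≤ r * n →
      (∀ {i σ} → P i σ → T (holds ℛ b σ) → Runs 1 c C (P (suc i)) σ) → P 0 σ₀ →
      Runs n (repeat e b c) (1 + cost ℛ e + (1 + testCost ℛ b) + r * (1 + testCost ℛ b + C))
        (λ σ → ∃[ i ] i ≤ ⟦_⟧ ℛ e σ₀ × P i σ) σ₀
    linear-loop {n} {r} P 1≤n e≤ body = loop {N₁ = 1} {N₂ = n} {r = r} P ≤-refl 1≤n (≤-reflexive (*-identityˡ n)) e≤
      (λ i< p h → i< , body p h)

    abstract
      -- Abstract, like the bounds of the later phases, so that neither the coefficient nor the
      -- proof unfolds where phases are combined.
      weigh-runs : ∃[ C ] ∀ {n k σ} → 1 ≤ n → k ≤ K → getReg ℛ Program.n σ ≡ n → getReg ℛ Program.k σ ≡ k →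
        getReg ℛ Program.M σ ≤ K * n →
        Runs n Program.weigh C (λ σ → getReg ℛ Program.M σ ≤ K * n) σ
      weigh-runs = _ , λ {n} {k} {σ} 1≤n k≤K n≡ k≡ M≤ →
        allocate {r = K} {Q = λ _ → ⊤} 1≤n (nk≤ n≡ k≡ k≤K) _ then λ _ →
        step 1≤n (weaken (λ (_ , _ , M≤) → M≤)
          (linear-loop {r = K} (λ _ σ → getReg ℛ Program.M σ ≤ K * n) 1≤n M≤ (λ M≤ _ → straight ≤-refl M≤) M≤))
        where
        nk≤ : ∀ {n k a b} → a ≡ n → b ≡ k → k ≤ K → a * b ≤ K * n
        nk≤ {n} refl refl k≤K = ≤-trans (*-monoʳ-≤ n k≤K) (≤-reflexive (*-comm n K))

    -- Shuffling and the sample size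

    shuffle-runs : ∃[ C ] ∀ {n σ} → 1 ≤ n → getReg ℛ Program.M σ ≤ K * n → Runs n Program.shuffle C (λ _ → ⊤) σ
    shuffle-runs = _ , λ {n} {σ} 1≤n M≤ →
      step 1≤n (weaken (λ _ → _) (linear-loop {r = K} (λ _ _ → ⊤) 1≤n M≤ (λ _ _ → straight ≤-refl _) _))

    -- The round number i is tied to s because s ≤ M is derived from the cut-off of the loop after M
    -- rounds.
    record Sampling (M i sʳ Mʳ : ℕ) : Set where
      field
        M≡   : Mʳ ≡ M
        s≡   : sʳ ≡ i
        s¹⁰≤ : sʳ ^ 10 ≤ M ^ 9

    sampleTest : Test
    sampleTest = Program.power (! Program.s ⊕ lit 1) 10 ≺ Program.power (! Program.M) 9 ⊕ lit 1

    sampleTest-sound : ∀ σ → T (holds ℛ sampleTest σ) → (getReg ℛ Program.s σ + 1) ^ 10 ≤ getReg ℛ Program.M σ ^ 9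
    sampleTest-sound σ h = m<1+n⇒m≤n (subst₂ _<_
      (⟦power⟧ (! Program.s ⊕ lit 1) 10 σ)
      (trans (+-comm _ 1) (cong suc (⟦power⟧ (! Program.M) 9 σ)))
      (<ᵇ⇒< (⟦_⟧ ℛ (Program.power (! Program.s ⊕ lit 1) 10) σ) (⟦_⟧ ℛ (Program.power (! Program.M) 9) σ + 1) h))

    IsSampling : ℕ → ℕ → State ℛ → Set
    IsSampling M i σ = Sampling M i (getReg ℛ Program.s σ) (getReg ℛ Program.M σ)

    sampling-suc : ∀ {M i} σ → IsSampling M i σ → T (holds ℛ sampleTest σ) →
                   IsSampling M (suc i) (run ℛ (Program.s ≔ ! Program.s ⊕ lit 1) σ)
    sampling-suc {M} {i} σ sampling h = record
      { M≡ = M≡ ; s≡ = trans (cong (_+ 1) s≡) (+-comm i 1)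
      ; s¹⁰≤ = subst (λ x → (getReg ℛ Program.s σ + 1) ^ 10 ≤ x ^ 9) M≡ (sampleTest-sound σ h) }
      where open Sampling sampling

    sampleSize-runs : ∃[ C ] ∀ {n M σ} → 1 ≤ n → getReg ℛ Program.M σ ≡ M → M ≤ K * n →
      Runs n Program.sampleSize C (λ σ′ → Sampled M (getReg ℛ Program.s σ′)) σ
    sampleSize-runs = _ , λ {n} {M} {σ} 1≤n M≡ M≤ →
      step 1≤n (weaken
        (λ (i , i≤ , sampling) → record
          { s¹⁰≤M⁹ = Sampling.s¹⁰≤ sampling
          ; s≤M    = ≤-trans (≤-reflexive (Sampling.s≡ sampling)) (≤-trans i≤ (≤-reflexive M≡)) })
        (linear-loop {r = K} (IsSampling M) 1≤n (≤-trans (≤-reflexive M≡) M≤)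
          (λ {i} {σ} sampling h → straight ≤-refl (sampling-suc {M} {i} σ sampling h))
          (record { M≡ = M≡ ; s≡ = refl ; s¹⁰≤ = z≤n })))

    abstract
      initialise-runs : ∃[ C ] ∀ {n M σ} → 1 ≤ n → getReg ℛ Program.M σ ≡ M → M ≤ K * n →
        Runs n Program.initialise C (λ σ′ → Sampled M (getReg ℛ Program.s σ′)) σ
      initialise-runs = _ , λ {n} {M} {σ} 1≤n M≡ M≤ →
        proj₂ shuffle-runs 1≤n (≤-trans (≤-reflexive M≡) M≤) then λ _ →
        proj₂ sampleSize-runs 1≤n (trans (getReg-run Program.M Program.shuffle _ σ) M≡) M≤ then λ s≤ →
        straight 1≤n s≤

    -- One iteration of the gradient descent

    HasDim : State ℛ → Set
    HasDim σ = getReg ℛ Program.d σ ≡ d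

    -- d is fixed, so d rounds count as constant time. The numbers 4 and 2 are the overhead from
    -- `linear-loop`, as `! d` and `always` each cost 1.
    dim-loop : ∀ {c σ} → Straight c → (∀ σ → HasDim σ → HasDim (run ℛ c σ)) → HasDim σ →
      Runs 1 (repeat (! Program.d) always c) (4 + d * (2 + maxTime c)) HasDim σ
    dim-loop {c} {σ} s keeps d≡ = weaken (λ (_ , _ , d≡) → d≡)
      (linear-loop {r = d} (λ _ → HasDim) ≤-refl (≤-reflexive (trans d≡ (sym (*-identityʳ d))))
        (λ {_} {σ} d≡ _ → straight {c = c} {s = s} ≤-refl (keeps σ d≡)) d≡)

    descend-runs : ∃[ C ] ∀ {σ} → HasDim σ → Runs 1 Program.descend C HasDim σ
    descend-runs = _ , λ d≡ →
      step ≤-refl (step ≤-refl (step ≤-refl (step ≤-refl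
        (dim-loop _ (λ _ d≡ → d≡) d≡ then λ d≡ →
      step ≤-refl (step ≤-refl (step ≤-refl (dim-loop _ (λ _ d≡ → d≡) d≡)))))))

    sampled-edge-runs : ∃[ C ] ∀ {σ} → HasDim σ →
      Runs 1 (Program.e ≔ (! Program.j ⊕ ! Program.i) mod ! Program.M ⨾ Program.descend ⨾ Program.i ≔ ! Program.i ⊕ lit 1) C HasDim σ
    sampled-edge-runs = _ , λ d≡ → step ≤-refl (proj₂ descend-runs d≡ then λ d≡ → straight ≤-refl d≡)

    abstract
      -- The scale is s + 1 for the s of the initial state. This one bound serves both the sublinear
      -- estimate and, after `rescale`, the linear one needed for the total time.
      iteration-runs : ∃[ C ] ∀ {σ} → HasDim σ → Runs (getReg ℛ Program.s σ + 1) Program.iteration C (λ _ → ⊤) σ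
      iteration-runs = _ , λ {σ} d≡ → let 1≤ = m≤n+m 1 (getReg ℛ Program.s σ) in
        step 1≤ (_then_
          (linear-loop {r = 1} (λ _ → HasDim) 1≤ (≤-reflexive (sym (*-identityˡ (getReg ℛ Program.s σ + 1))))
            (λ d≡ _ → proj₂ sampled-edge-runs d≡) d≡)
          λ _ → straight 1≤ _)

  -- Bounds for all instances

  module Uniform (K d t A : ℕ) where

    -- The coefficient of partialBFS-runs is found with k and n in scope, but it
    -- computes to an expression in K alone.
    abstract
      partialBFS-instance-runs : ∃[ C ] ∀ (x : Instance ℛ K d t A) → 1 ≤ n x →
        Runs (n x) Program.partialBFS C (λ σ → getReg ℛ Program.M σ ≤ K * n x) (start x)
      partialBFS-instance-runs = _ , λ x 1≤n →
        proj₂ (Search.partialBFS-runs (Instance.k x) K (Instance.k≤K x) (nth (offsets ℛ (Instance.G′ x)))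
          (λ {i} {j} p∈i p∈j → block-unique (adjacencyLists ℛ (Instance.G′ x)) i j
             (offsets⇒blockStart (Instance.G′ x) i p∈i) (offsets⇒blockStart (Instance.G′ x) j p∈j)) 1≤n)
          refl (record
            { k≡ = refl
            ; offset≡ = read-intArray (offsets ℛ (Instance.G′ x))
            ; blocked = record
              { inside = λ {i} p∈ → block-inside (adjacencyLists ℛ (Instance.G′ x)) i (offsets⇒blockStart (Instance.G′ x) i p∈)
              ; injective = λ {i} {p} {q} p∈ q∈ eq → block-injective (adjacencyLists-unique (Instance.G′ x)) i
                  (offsets⇒blockStart (Instance.G′ x) i p∈) (offsets⇒blockStart (Instance.G′ x) i q∈)
                  (trans (sym (read-intArray (concat (adjacencyLists ℛ (Instance.G′ x))) p))
                  (trans eq (read-intArray (concat (adjacencyLists ℛ (Instance.G′ x))) q)))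
              } })

    open Descent K d

    n-partialBFS : ∀ (x : Instance ℛ K d t A) → getReg ℛ Program.n (run ℛ Program.partialBFS (start x)) ≡ n x
    n-partialBFS x = getReg-run Program.n Program.partialBFS _ (start x)

    k-partialBFS : ∀ (x : Instance ℛ K d t A) → getReg ℛ Program.k (run ℛ Program.partialBFS (start x)) ≡ Instance.k x
    k-partialBFS x = getReg-run Program.k Program.partialBFS _ (start x)

    abstract
      knnGraph-runs : ∃[ C ] ∀ (x : Instance ℛ K d t A) → 1 ≤ n x →
        Runs (n x) Program.knnGraph C (λ σ → getReg ℛ Program.M σ ≤ K * n x) (start x)
      knnGraph-runs = _ , λ x 1≤n →
        proj₂ partialBFS-instance-runs x 1≤n then λ M≤ →
          proj₂ weigh-runs 1≤n (Instance.k≤K x) (n-partialBFS x) (k-partialBFS x) M≤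

    M≤K*n : ∀ x → 1 ≤ n x → getReg ℛ Program.M (run ℛ Program.knnGraph (start x)) ≤ K * n x
    M≤K*n x 1≤n = Runs.post (proj₂ knnGraph-runs x 1≤n)

    getReg-initialised : ∀ r {_ : Unassigned r Program.initialise} {_ : Unassigned r Program.knnGraph} (x : Instance ℛ K d t A) →
      getReg ℛ r (run ℛ Program.initialise (run ℛ Program.knnGraph (start x))) ≡ getReg ℛ r (start x)
    getReg-initialised r {u} {u′} x =
      trans (getReg-run r Program.initialise u (run ℛ Program.knnGraph (start x))) (getReg-run r Program.knnGraph u′ (start x))

    d-initialised : ∀ (x : Instance ℛ K d t A) → getReg ℛ Program.d (run ℛ Program.initialise (run ℛ Program.knnGraph (start x))) ≡ d
    d-initialised x = getReg-initialised Program.d x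

    t-initialised : ∀ (x : Instance ℛ K d t A) → getReg ℛ Program.t (run ℛ Program.initialise (run ℛ Program.knnGraph (start x))) ≡ t
    t-initialised x = getReg-initialised Program.t x

    abstract
      initialise-instance-runs : ∃[ C ] ∀ (x : Instance ℛ K d t A) → 1 ≤ n x →
        Runs (n x) Program.initialise C
          (λ σ → Sampled (getReg ℛ Program.M (run ℛ Program.knnGraph (start x))) (getReg ℛ Program.s σ))
          (run ℛ Program.knnGraph (start x))
      initialise-instance-runs = _ , λ x 1≤n →
        proj₂ initialise-runs {n x} {getReg ℛ Program.M (run ℛ Program.knnGraph (start x))}
          {run ℛ Program.knnGraph (start x)} 1≤n refl (M≤K*n x 1≤n)

    sampled : ∀ (x : Instance ℛ K d t A) → 1 ≤ n x →
      Sampled (getReg ℛ Program.M (run ℛ Program.knnGraph (start x)))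
              (getReg ℛ Program.s (run ℛ Program.initialise (run ℛ Program.knnGraph (start x))))
    sampled x 1≤n = Runs.post (proj₂ initialise-instance-runs x 1≤n)

    s+1≤ : ∀ {M s n} → 1 ≤ n → M ≤ K * n → Sampled M s → s + 1 ≤ suc K * n
    s+1≤ {n = n} 1≤n M≤ s = ≤-trans (+-mono-≤ (≤-trans (Sampled.s≤M s) M≤) 1≤n) (≤-reflexive (+-comm (K * n) n))

    getReg-beforeIteration : ∀ r {_ : Unassigned r Program.iteration} (x : Instance ℛ K d t A) i →
      getReg ℛ r (beforeIteration ℛ x i) ≡ getReg ℛ r (run ℛ Program.initialise (run ℛ Program.knnGraph (start x)))
    getReg-beforeIteration r     x zero    = refl
    getReg-beforeIteration r {u} x (suc i) = trans (getReg-run r Program.iteration u (beforeIteration ℛ x i))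
      (getReg-beforeIteration r {u} x i)

    -- The threshold 1 excludes the empty graph, where the constant overhead exceeds every multiple
    -- of n.
    timeC0-linear : timeC0 ℛ =O[ n ] n
    timeC0-linear = proj₁ partialBFS-instance-runs , 1 , λ x 1≤n → Runs.time≤ (proj₂ partialBFS-instance-runs x 1≤n)

    timeC1-linear : timeC1 ℛ =O[ n ] n
    timeC1-linear = proj₁ knnGraph-runs , 1 , λ x 1≤n → Runs.time≤ (proj₂ knnGraph-runs x 1≤n)

    d-beforeIteration : ∀ (x : Instance ℛ K d t A) i → getReg ℛ Program.d (beforeIteration ℛ x i) ≡ d
    d-beforeIteration x i = trans (getReg-beforeIteration Program.d x i) (d-initialised x)

    iteration-time : ∀ σ → getReg ℛ Program.d σ ≡ d → ∀ {s} → getReg ℛ Program.s σ ≡ s →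
                     time ℛ Program.iteration σ ≤ proj₁ iteration-runs * (s + 1)
    iteration-time σ d≡ refl = Runs.time≤ (proj₂ iteration-runs {σ} d≡)

    timeC2≤ : ∀ (p : Instance ℛ K d t A × Fin t) → timeC2 ℛ p ≤
      proj₁ iteration-runs * (getReg ℛ Program.s (run ℛ Program.initialise (run ℛ Program.knnGraph (start (proj₁ p)))) + 1)
    timeC2≤ (x , i) = iteration-time (beforeIteration ℛ x (toℕ i)) (d-beforeIteration x (toℕ i))
      {getReg ℛ Program.s (run ℛ Program.initialise (run ℛ Program.knnGraph (start x)))} (getReg-beforeIteration Program.s x (toℕ i))

    timeC2-sublinear : timeC2 ℛ =O[ n ∘ proj₁ ] (n ∘ proj₁) ^0·9
    timeC2-sublinear = proj₁ iteration-runs * (2 * suc K) , 1 , λ p 1≤n →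
      sampled⇒sublinear (timeC2 ℛ p) (proj₁ iteration-runs) K ((n ∘ proj₁) p)
        {getReg ℛ Program.M (run ℛ Program.knnGraph (start (proj₁ p)))}
        {getReg ℛ Program.s (run ℛ Program.initialise (run ℛ Program.knnGraph (start (proj₁ p))))}
        1≤n (timeC2≤ p) (sampled (proj₁ p) 1≤n) (M≤K*n (proj₁ p) 1≤n)

    record Iterating (M s d′ : ℕ) : Set where
      field
        isSampled : Sampled M s
        d≡        : d′ ≡ d

    iteration-keeps : ∀ M σ → Iterating M (getReg ℛ Program.s σ) (getReg ℛ Program.d σ) →
      Iterating M (getReg ℛ Program.s (run ℛ Program.iteration σ)) (getReg ℛ Program.d (run ℛ Program.iteration σ))
    iteration-keeps M σ it = record
      { isSampled = subst (Sampled M) (sym (getReg-run Program.s Program.iteration _ σ)) (Iterating.isSampled it)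
      ; d≡ = trans (getReg-run Program.d Program.iteration _ σ) (Iterating.d≡ it) }

    abstract
      iteration-linear : ∃[ C ] ∀ {n M σ} → 1 ≤ n → M ≤ K * n → Iterating M (getReg ℛ Program.s σ) (getReg ℛ Program.d σ) →
        Runs n Program.iteration C (λ σ → Iterating M (getReg ℛ Program.s σ) (getReg ℛ Program.d σ)) σ
      iteration-linear = proj₁ iteration-runs * suc K , λ {n} {M} {σ} 1≤n M≤ it → runs
        (Runs.time≤ (rescale {r = suc K} (s+1≤ 1≤n M≤ (Iterating.isSampled it)) (proj₂ iteration-runs {σ} (Iterating.d≡ it))))
        (iteration-keeps M σ it)

    abstract
      iterations-runs : ∃[ C ] ∀ {n M σ} → 1 ≤ n → M ≤ K * n → getReg ℛ Program.t σ ≡ t →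
        Iterating M (getReg ℛ Program.s σ) (getReg ℛ Program.d σ) →
        Runs n (repeat (! Program.t) always Program.iteration) C (λ _ → ⊤) σ
      iterations-runs = _ , λ {n} {M} {σ} 1≤n M≤ t≡ it → weaken (λ _ → _)
        -- Unlike in the other loops, here a round takes linear time and the number of rounds is
        -- constant, so `N₁` carries the n.
        (loop {N₁ = n} {N₂ = 1} {B = t} {r = t} (λ _ σ → Iterating M (getReg ℛ Program.s σ) (getReg ℛ Program.d σ))
          1≤n ≤-refl (≤-reflexive (*-identityʳ n)) (≤-reflexive (sym (*-identityʳ t)))
          (λ i< it _ → <-≤-trans i< (≤-reflexive t≡) , proj₂ iteration-linear 1≤n M≤ it) it)

    abstract
      iterations-instance-runs : ∃[ C ] ∀ (x : Instance ℛ K d t A) → 1 ≤ n x →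
        Runs (n x) (repeat (! Program.t) always Program.iteration) C (λ _ → ⊤)
          (run ℛ Program.initialise (run ℛ Program.knnGraph (start x)))
      iterations-instance-runs = _ , λ x 1≤n →
        proj₂ iterations-runs {n x} {getReg ℛ Program.M (run ℛ Program.knnGraph (start x))} 1≤n (M≤K*n x 1≤n) (t-initialised x)
          (record { isSampled = sampled x 1≤n ; d≡ = d-initialised x })

      SSSL-GUMAP-runs : ∃[ C ] ∀ (x : Instance ℛ K d t A) → 1 ≤ n x → Runs (n x) Program.SSSL-GUMAP C (λ _ → ⊤) (start x)
      SSSL-GUMAP-runs = _ , λ x 1≤n → proj₂ knnGraph-runs x 1≤n then λ _ →
        proj₂ initialise-instance-runs x 1≤n then λ _ → proj₂ iterations-instance-runs x 1≤n

    timeTotal-linear : timeTotal ℛ =O[ n ] n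
    timeTotal-linear = proj₁ SSSL-GUMAP-runs , 1 , λ x 1≤n → Runs.time≤ (proj₂ SSSL-GUMAP-runs x 1≤n)

    -- Space

    ∣E′∣≤m : ∀ (x : Instance ℛ K d t A) → ∣E Instance.G′ x ∣ ≤ m x
    ∣E′∣≤m x = Unique-⊆⇒length≤ (Graph.unique (Instance.G′ x)) (IsSpectralSparsification.subgraph (Instance.sparse x))

    -- The summands are 64 for the registers, d for X, 1 for σ, 2 for `adjacent` (every edge of G′
    -- appears twice, and E′ ⊆ E), 2 for the n + 1 offsets, and 2 for the endpoints stored in
    -- `graph`.
    used-start≤ : ∀ (x : Instance ℛ K d t A) → 1 ≤ n x → State.used (start x) ≤ (64 + d + 1 + 2 + 2 + 2) * (n x + m x)
    used-start≤ x 1≤n =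
      sum≤ (64 + d + 1 + 2 + 2) 2 (sum≤ (64 + d + 1 + 2) 2 (sum≤ (64 + d + 1) 2 (sum≤ (64 + d) 1 (sum≤ 64 d
        (const≤ 64)
        (≤-trans (≤-reflexive (*-comm (n x) d)) (*-monoʳ-≤ d n≤N)))
        (≤-trans n≤N (≤-reflexive (sym (*-identityˡ N)))))
        adjacent≤)
        offset≤)
        graph≤
      where
      N = n x + m x
      sum≤ : ∀ C D {a b} → a ≤ C * N → b ≤ D * N → a + b ≤ (C + D) * N
      sum≤ C D a≤ b≤ = ≤-trans (+-mono-≤ a≤ b≤) (≤-reflexive (sym (*-distribʳ-+ N C D)))
      n≤N : n x ≤ N
      n≤N = m≤m+n (n x) (m x)
      m≤N : m x ≤ N
      m≤N = m≤n+m (m x) (n x)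
      const≤ : ∀ c → c ≤ c * N
      const≤ c = m≤m*n c N {{>-nonZero (≤-trans 1≤n n≤N)}}
      adjacent≤ : length (concat (adjacencyLists ℛ (Instance.G′ x))) ≤ 2 * N
      adjacent≤ = ≤-trans (length-adjacencyLists (Instance.G′ x)) (*-monoʳ-≤ 2 (≤-trans (∣E′∣≤m x) m≤N))
      offset≤ : length (offsets ℛ (Instance.G′ x)) ≤ 2 * N
      offset≤ = ≤-trans (≤-reflexive (length-offsets (Instance.G′ x)))
        (≤-trans (+-mono-≤ (≤-trans 1≤n n≤N) n≤N) (≤-reflexive (cong (N +_) (sym (+-identityʳ N)))))
      graph≤ : length (endpoints ℛ (Instance.G x)) ≤ 2 * N
      graph≤ = ≤-trans (≤-reflexive (length-endpoints (Instance.G x))) (*-monoʳ-≤ 2 m≤N)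

    -- With the array sizes evaluated, the states below stay small when they are
    -- unfolded; otherwise the last refl of theorem4 compares huge terms.
    zeros : ∀ s → ℕ → Array ℛ s
    zeros s m = array (Vector.replicate m (zeroVal ℛ s))

    prepared afterBFS : Instance ℛ K d t A → State ℛ
    prepared x =
      let N = n x ; k = Instance.k x in
      setReg ℛ Program.v 0 (setReg ℛ Program.M 0
      (input ℛ Program.ρ (zeros real N)
      (input ℛ Program.distance (zeros int (N * k))
      (input ℛ Program.target (zeros int (N * k))
      (input ℛ Program.source (zeros int (N * k))
      (input ℛ Program.level (zeros int (k + 1))
      (input ℛ Program.queue (zeros int (k + 1))
      (input ℛ Program.mark (zeros int N)
      (start x)))))))))
    afterBFS x = runLoop ℛ (n x) always (run ℛ (Program.search ⨾ Program.v ≔ ! Program.v ⊕ lit 1)) (prepared x)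

    knnGraph-afterBFS : ∀ (x : Instance ℛ K d t A) → run ℛ Program.knnGraph (start x) ≡ run ℛ Program.weigh (afterBFS x)
    knnGraph-afterBFS x = refl

    startBound spaceBound : ℕ
    startBound = 64 + d + 1 + 2 + 2 + 2
    spaceBound = startBound + proj₁ knnGraph-runs + proj₁ initialise-instance-runs + proj₁ iterations-instance-runs

    used-final≤ : ∀ (x : Instance ℛ K d t A) → 1 ≤ n x →
      State.used (run ℛ (repeat (! Program.t) always Program.iteration)
        (run ℛ Program.initialise (run ℛ Program.knnGraph (start x)))) ≤ spaceBound * (n x + m x)
    used-final≤ x 1≤n =
      used-linear (repeat (! Program.t) always Program.iteration) (run ℛ Program.initialise (run ℛ Program.knnGraph (start x)))
        (proj₁ iterations-instance-runs) (startBound + proj₁ knnGraph-runs + proj₁ initialise-instance-runs) (n x) (n x + m x)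
        (proj₂ iterations-instance-runs x 1≤n) (m≤m+n (n x) (m x))
      (used-linear Program.initialise (run ℛ Program.knnGraph (start x))
        (proj₁ initialise-instance-runs) (startBound + proj₁ knnGraph-runs) (n x) (n x + m x)
        (proj₂ initialise-instance-runs x 1≤n) (m≤m+n (n x) (m x))
      (used-linear Program.knnGraph (start x)
        (proj₁ knnGraph-runs) startBound (n x) (n x + m x)
        (proj₂ knnGraph-runs x 1≤n) (m≤m+n (n x) (m x))
        (used-start≤ x 1≤n)))

    used-final-afterBFS≤ : ∀ (x : Instance ℛ K d t A) → 1 ≤ n x →
      State.used (run ℛ (repeat (! Program.t) always Program.iteration)
        (run ℛ Program.initialise (run ℛ Program.weigh (afterBFS x)))) ≤ spaceBound * (n x + m x)
    used-final-afterBFS≤ x 1≤n =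
      subst (λ σ → State.used (run ℛ (repeat (! Program.t) always Program.iteration) (run ℛ Program.initialise σ))
                   ≤ spaceBound * (n x + m x))
        (knnGraph-afterBFS x) (used-final≤ x 1≤n)

    -- `f` is left open so that `space` is unfolded only once, by the `refl` in the theorem, and
    -- compared with the state built on `afterBFS`.
    space-linear : ∀ {f : Instance ℛ K d t A → ℕ} →
      (∀ x → f x ≡ State.used (run ℛ (repeat (! Program.t) always Program.iteration)
        (run ℛ Program.initialise (run ℛ Program.weigh (afterBFS x))))) →
      f =O[ n ] (λ x → n x + m x)
    space-linear f≡ = spaceBound , 1 , λ x 1≤n → ≤-trans (≤-reflexive (f≡ x)) (used-final-afterBFS≤ x 1≤n)

theorem4 : (ℛ : RealArithmetic) (K d t A : ℕ) → let open Complexity ℛ in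
    (timeC0 {K} {d} {t} {A} =O[ n ] n)
    × (timeC1 {K} {d} {t} {A} =O[ n ] n)
    × (timeC2 {K} {d} {t} {A} =O[ n ∘ proj₁ ] (n ∘ proj₁) ^0·9)
    × (timeTotal {K} {d} {t} {A} =O[ n ] n)
    × (space {K} {d} {t} {A} =O[ n ] (λ x → n x + m x))
theorem4 ℛ K d t A = timeC0-linear , timeC1-linear , timeC2-sublinear , timeTotal-linear , space-linear (λ _ → refl)
  where open Analysis ℛ
        open Uniform K d t A
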